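{- Let $n\ge 6$ and let $Q\subseteq\mathbb{R}^d$, with linear map $p$, be a weakly symmetric subspace extension of the permutahedron $\Pi_n$ with $d<\frac{n(n-1)}{2}$, with respect to $G=S_n$, and let $s=(s_1,\dots,s_d):X\to Q$ be a section as in the definition of weak symmetry. Then there exists a partition of $\{1,\dots,d\}$ into sets $\mathcal{A}_i$ and $\mathcal{B}_j$ such that each $\mathcal{B}_j$ consists of a single element $b_j$ and each $\mathcal{A}_i$ consists of $n$ elements $a^i_1,a^i_2,\dots,a^i_n$, with $$s_{a^i_t}(\pi.x)=s_{a^i_{\pi^{ -1}(t)}}(x)\qquad\text{and}\qquad s_{b_j}(\pi.x)=s_{b_j}(x)$$ for every vertex $x\in X$, every $t\in\{1,\dots,n\}$, all $i,j$, and all $\pi\in A_n$.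
   Context: $\Pi_n$ is the convex hull of all coordinate permutations of $(1,2,\dots,n)$, with vertex set $X=\{(\zeta^{ -1}(1),\dots,\zeta^{ -1}(n)):\zeta\in S_n\}$. $S_n$ acts on $\mathbb{R}^n$ by $(\pi.x)_v=x_{\pi^{ -1}(v)}$ and $S_d$ acts on $\mathbb{R}^d$ by $(\varkappa.y)_j=y_{\varkappa^{ -1}(j)}$. A subspace extension of $\Pi_n$ is a set $Q\subseteq\mathbb{R}^d$ that is the intersection of an affine subspace with $\mathbb{R}^d_+$, together with a linear map $p:\mathbb{R}^d\to\mathbb{R}^n$ with $p(Q)=\Pi_n$. A section is a map $s:X\to Q$ with $p(s(x))=x$; the extension is weakly symmetric if there is a section $s$ such that for each $\pi\in S_n$ there is $\varkappa_\pi\in S_d$ with $s(\pi.x)=\varkappa_\pi.s(x)$ for all $x\in X$. $A_n$ denotes the alternating group on $\{1,\dots,n\}$. -}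

module Defs where

open import Algebra.Bundles using (CommutativeRing)
open import Algebra.Module.Bundles.Raw using (RawLeftModule)
open import Algebra.Module.Morphism.Structures using (module LeftModuleMorphisms)
open import Data.Fin.Base using (Fin; toℕ)
open import Data.Fin.Permutation as Perm using (Permutation′; _⟨$⟩ˡ_; _∘ₚ_)
open import Data.Fin.Permutation.Transposition.List using (TranspositionList; eval)
open import Data.List.Base using (length)
open import Data.List.Relation.Unary.All using (All)
open import Data.Nat.Base using (ℕ; suc)
open import Data.Nat.Divisibility using (_∣_)
open import Data.Product.Base using (Σ; ∃; ∃-syntax; _×_; _,_; proj₁)
open import Data.Sum.Base using (_⊎_; inj₁; inj₂)
open import Data.Vec.Functional using (Vector)
open import Function.Base using (_on_)
open import Function.Bundles using (Func; _⇔_; _↔_; Inverse)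
open import Level using (0ℓ)
open import Relation.Binary.Bundles using (Setoid)
open import Relation.Binary.PropositionalEquality.Core using (_≢_)
open import Relation.Binary.Structures using (IsDecTotalOrder)
import Relation.Binary.Construct.On as On
open import Relation.Nullary.Negation.Core using (¬_)
open import Relation.Unary using (Pred)

-- The real numbers, axiomatised as a Dedekind-complete ordered field, which
-- classically determines them up to unique isomorphism. As in classical
-- mathematics the order is decidable and suprema exist for arbitrary
-- predicates, so a model can only be expected under excluded middle.
record Reals : Set₁ where
  field
    commutativeRing : CommutativeRing 0ℓ 0ℓ

  open CommutativeRing commutativeRing public

  infix 4 _≤_

  field
    _≤_             : Carrier → Carrier → Set
    isDecTotalOrder : IsDecTotalOrder _≈_ _≤_

  UpperBound : Pred Carrier 0ℓ → Pred Carrier 0ℓ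
  UpperBound P u = ∀ x → P x → x ≤ u

  field
    0≉1       : ¬ (0# ≈ 1#)
    inverse   : ∀ x → ¬ (x ≈ 0#) → ∃[ y ] x * y ≈ 1#
    +-monoˡ-≤ : ∀ z {x y} → x ≤ y → x + z ≤ y + z
    *-nonneg  : ∀ {x y} → 0# ≤ x → 0# ≤ y → 0# ≤ x * y
    supremum  : (P : Pred Carrier 0ℓ) → ∃ P → ∃ (UpperBound P) →
                ∃[ u ] UpperBound P u × (∀ v → UpperBound P v → u ≤ v)

-- The alternating group: products of an even number of transpositions. A
-- TranspositionList may contain trivial pairs (i , i), which are not
-- transpositions and have to be excluded.
Alternating : ∀ n → Pred (Permutation′ n) 0ℓ
Alternating n π = Σ (TranspositionList n) λ ts →
  All (λ (i , j) → i ≢ j) ts × 2 ∣ length ts × π Perm.≈ eval ts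

-- A partition of Fin d into k blocks of n elements each, every block being
-- enumerated, and m singletons. Bijectivity says that the elements a i t and
-- b j are pairwise distinct and exhaust Fin d.
LabelledPartition : (d n k m : ℕ) → Set
LabelledPartition d n k m = ((Fin k × Fin n) ⊎ Fin m) ↔ Fin d

module LabelledPartition {d n k m : ℕ} (P : LabelledPartition d n k m) where

  a : Fin k → Fin n → Fin d
  a i t = Inverse.to P (inj₁ (i , t))

  b : Fin m → Fin d
  b j = Inverse.to P (inj₂ j)

module Extensions (ℝ : Reals) where
  open Reals ℝ
  open import Algebra.Definitions.RawMonoid +-rawMonoid using (sum)
    renaming (_×_ to _×#_)
  open import Data.Vec.Functional.Relation.Binary.Equality.Setoid setoid
    using (_≋_; ≋-setoid)

  vectorSpace : ℕ → RawLeftModule Carrier 0ℓ 0ℓ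
  vectorSpace n = record
    { Carrierᴹ = Vector Carrier n
    ; _≈ᴹ_     = _≋_
    ; _+ᴹ_     = λ x y v → x v + y v
    ; _*ₗ_     = λ c x v → c * x v
    ; 0ᴹ       = λ _ → 0#
    ; -ᴹ_      = λ x v → - x v
    }

  IsLinear : ∀ {d n} → (Vector Carrier d → Vector Carrier n) → Set
  IsLinear {d} {n} =
    LeftModuleMorphisms.IsLeftModuleHomomorphism (vectorSpace d) (vectorSpace n)

  record IsAffineSubspace {d} (L : Pred (Vector Carrier d) 0ℓ) : Set where
    field
      respects : ∀ {y z} → y ≋ z → L y → L z
      line     : ∀ c {y z} → L y → L z →
                 L (λ v → c * y v + (1# - c) * z v)

  Nonnegative : ∀ {d} → Pred (Vector Carrier d) 0ℓ
  Nonnegative y = ∀ j → 0# ≤ y j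

  ConvexHull : ∀ {n} → Pred (Vector Carrier n) 0ℓ → Pred (Vector Carrier n) 0ℓ
  ConvexHull {n} S x =
    ∃[ k ] Σ (Vector Carrier k) λ w → Σ (Fin k → Vector Carrier n) λ z →
      (∀ i → S (z i)) × Nonnegative w × sum w ≈ 1# ×
      x ≋ (λ v → sum (λ i → w i * z i v))

  infixr 7 _∙_

  _∙_ : ∀ {n} → Permutation′ n → Vector Carrier n → Vector Carrier n
  (π ∙ x) v = x (π ⟨$⟩ˡ v)

  -- Fin is 0-based whereas coordinates of vertices range over 1, …, n.
  vertex : ∀ {n} → Permutation′ n → Vector Carrier n
  vertex ζ v = suc (toℕ (ζ ⟨$⟩ˡ v)) ×# 1#

  IsVertex : ∀ n → Pred (Vector Carrier n) 0ℓ
  IsVertex n x = Σ (Permutation′ n) λ ζ → x ≋ vertex ζ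

  Permutahedron : ∀ n → Pred (Vector Carrier n) 0ℓ
  Permutahedron n = ConvexHull (IsVertex n)

  -- Vertices are compared as points of ℝⁿ: the permutation witnessing
  -- membership is ignored.
  X : ℕ → Setoid 0ℓ 0ℓ
  X n = record
    { Carrier       = ∃ (IsVertex n)
    ; _≈_           = _≋_ on proj₁
    ; isEquivalence = On.isEquivalence proj₁ (Setoid.isEquivalence (≋-setoid n))
    }

  infixr 7 _∙ˣ_

  _∙ˣ_ : ∀ {n} → Permutation′ n → Setoid.Carrier (X n) → Setoid.Carrier (X n)
  π ∙ˣ (x , ζ , x≋ζ) = π ∙ x , ζ ∘ₚ π , λ v → x≋ζ (π ⟨$⟩ˡ v)

  MapFromX : ℕ → ℕ → Set
  MapFromX n d = Func (X n) (≋-setoid d)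

  record IsSubspaceExtension {d n} (Q : Pred (Vector Carrier d) 0ℓ)
                             (p : Vector Carrier d → Vector Carrier n) : Set₁ where
    field
      linear           : IsLinear p
      L                : Pred (Vector Carrier d) 0ℓ
      isAffineSubspace : IsAffineSubspace L
      Q-intersection   : ∀ y → Q y ⇔ (L y × Nonnegative y)
      p-image          : ∀ x → Permutahedron n x ⇔ (∃[ y ] Q y × p y ≋ x)

  record IsSection {d n} (Q : Pred (Vector Carrier d) 0ℓ)
                   (p : Vector Carrier d → Vector Carrier n)
                   (s : MapFromX n d) : Set where
    open Func s
    field
      into-Q  : ∀ x → Q (to x)
      p-right : ∀ x → p (to x) ≋ proj₁ x

  record IsWeaklySymmetricSection {d n} (Q : Pred (Vector Carrier d) 0ℓ)
                                  (p : Vector Carrier d → Vector Carrier n)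
                                  (s : MapFromX n d) : Set where
    open Func s
    field
      isSection : IsSection Q p s
      symmetric : ∀ (π : Permutation′ n) → Σ (Permutation′ d) λ ϰ →
                  ∀ x → to (π ∙ˣ x) ≋ ϰ ∙ to x

{-# OPTIONS --safe #-}

-- The hypotheses are contradictory: no weakly symmetric subspace extension has d < n(n-1)/2.
-- For a vertex written as ζ let T_j(a,v) be the sum of s_j over all ζ with coordinate v at position a.
-- Permuting the positions a permutes the matrices T_j, so a small d forces each T_j to have all rows
-- equal except one, because any other matrix has at least n(n-1)/2 row arrangements. For such matrices,
-- a matrix D with constant row and column sums yields a point y, a (possibly not convex) affine
-- combination of section points, with y_j a positive multiple of Σ_v D(a_j,v) T_j(a_j,v), where a_j is
-- the exceptional row; similarly p(y)_b is a positive multiple of Σ_v D(b,v) v. Take D slightly beyond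
-- the barycentre of the facet "the first m positions carry 1, …, m". Nonnegativity of y can fail only
-- if, for some j, row a_j of T_j has its first or last nonzero entry right at the threshold m. Every row
-- obstructs at most two thresholds, and obstructions come in S_n-orbits of size at least n, so
-- obstructing all n-1 thresholds takes at least n(n-1)/2 indices j. For an unobstructed threshold,
-- y lies in Q and p(y) lies outside the permutahedron.
module Submission where

open import Defs
open import Algebra.Bundles using (CommutativeRing; RawRing)
open import Algebra.Module.Morphism.Structures using (module LeftModuleMorphisms)
import Algebra.Properties.AbelianGroup
import Algebra.Properties.CommutativeSemigroup
import Algebra.Properties.Ring
import Algebra.Properties.Semiring.Mult
import Algebra.Properties.Semiring.Sum
import Algebra.Solver.Ring
open import Algebra.Solver.Ring.AlmostCommutativeRing using (fromCommutativeRing; _-Raw-AlmostCommutative⟶_)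
open import Data.Bool.Base using (Bool; true; false; if_then_else_; not)
open import Data.Empty using (⊥; ⊥-elim)
open import Data.Fin.Base using (Fin; zero; suc; toℕ; inject₁; punchIn; punchOut; combine; remQuot; splitAt)
open import Data.Fin.Patterns using (0F; 1F; 2F; 3F)
open import Data.Fin.Permutation as Perm using (Permutation′; _⟨$⟩ʳ_; _⟨$⟩ˡ_; insert; remove)
open import Data.Fin.Properties
  using (_≟_; any?; all?; <⇒≢; toℕ-injective; toℕ-inject₁; punchIn-injective; punchIn-punchOut; punchInᵢ≢i;
         combine-injective; combine-remQuot; remQuot-combine; injective⇒≤; pigeonhole; +↔⊎)
open import Data.Maybe.Base using (Maybe; just; nothing)
open import Data.Nat.Base as ℕ using (ℕ; zero; suc; _!)
import Data.Nat.DivMod as ℕ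
import Data.Nat.Properties as ℕ
open import Data.Product.Base using (Σ; ∃; ∃-syntax; _×_; _,_; proj₁; proj₂)
open import Data.Product.Properties using (≡-dec)
open import Data.Sum.Base using (_⊎_; inj₁; inj₂; [_,_]′; swap)
open import Data.Vec.Functional using (Vector; []; _∷_; removeAt)
import Data.Vec.Functional.Relation.Binary.Pointwise.Properties as Pointwise
open import Function.Base using (_∘_)
open import Function.Bundles using (Func; Injection; Equivalence)
open import Function.Properties.Inverse using (↔⇒↣)
open import Level using (0ℓ)
open import Relation.Binary.Bundles using (Setoid; DecSetoid)
open import Relation.Binary.Definitions using (tri<; tri≈; tri>)
open import Relation.Binary.PropositionalEquality as ≡ using (_≡_; _≢_; cong; cong₂)
import Relation.Binary.Reasoning.Setoid
open import Relation.Binary.Structures using (IsDecTotalOrder)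
open import Relation.Nullary.Decidable using (yes; no; does; ¬?; _×-dec_; dec-true; dec-false; decidable-stable)
open import Relation.Nullary.Negation using (¬_; contradiction)
open import Relation.Unary using (Pred)

-- Enumeration of the symmetric group.

mutual
  enumerate : ∀ n → Fin (n !) → Permutation′ n
  enumerate zero    _ = Perm.id
  enumerate (suc n) i = enumerate-× n (remQuot (n !) i)

  -- The pair is an argument of its own so that it can be rewritten by congruence.
  enumerate-× : ∀ n → Fin (suc n) × Fin (n !) → Permutation′ (suc n)
  enumerate-× n (j , k) = insert zero j (enumerate n k)

-- The Lehmer code of the permutation, read as a number in the factorial number system.
index : ∀ n → Permutation′ n → Fin (n !)
index zero    _ = zero
index (suc n) π = combine (π ⟨$⟩ʳ zero) (index n (remove zero π))

insert₀-cong : ∀ {n} {i j : Fin (suc n)} {π ρ : Permutation′ n} → i ≡ j → π Perm.≈ ρ →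
               insert zero i π Perm.≈ insert zero j ρ
insert₀-cong ≡.refl π≈ρ zero    = ≡.refl
insert₀-cong {i = i} ≡.refl π≈ρ (suc k) = cong (punchIn i) (π≈ρ k)

remove₀-cong : ∀ {n} {π ρ : Permutation′ (suc n)} → π Perm.≈ ρ → remove zero π Perm.≈ remove zero ρ
remove₀-cong {π = π} {ρ} π≈ρ k = punchIn-injective (π ⟨$⟩ʳ zero) _ _ (begin
  punchIn (π ⟨$⟩ʳ zero) (remove zero π ⟨$⟩ʳ k)  ≡⟨ Perm.punchIn-permute π zero k ⟨
  π ⟨$⟩ʳ suc k                                  ≡⟨ π≈ρ (suc k) ⟩
  ρ ⟨$⟩ʳ suc k                                  ≡⟨ Perm.punchIn-permute ρ zero k ⟩
  punchIn (ρ ⟨$⟩ʳ zero) (remove zero ρ ⟨$⟩ʳ k)  ≡⟨ cong (λ z → punchIn z _) (π≈ρ zero) ⟨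
  punchIn (π ⟨$⟩ʳ zero) (remove zero ρ ⟨$⟩ʳ k)  ∎)
  where open ≡.≡-Reasoning

index-cong : ∀ n {π ρ : Permutation′ n} → π Perm.≈ ρ → index n π ≡ index n ρ
index-cong zero    π≈ρ = ≡.refl
index-cong (suc n) {π} {ρ} π≈ρ =
  cong₂ combine (π≈ρ zero) (index-cong n (remove₀-cong {π = π} {ρ} π≈ρ))

enumerate-index : ∀ n π → enumerate n (index n π) Perm.≈ π
enumerate-index (suc n) π k = begin
  enumerate-× n (remQuot (n !) (combine (π ⟨$⟩ʳ zero) r)) ⟨$⟩ʳ k
    ≡⟨ cong (λ x → enumerate-× n x ⟨$⟩ʳ k) (remQuot-combine (π ⟨$⟩ʳ zero) r) ⟩
  insert zero (π ⟨$⟩ʳ zero) (enumerate n r) ⟨$⟩ʳ k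
    ≡⟨ insert₀-cong {π = enumerate n r} {remove zero π} ≡.refl (enumerate-index n (remove zero π)) k ⟩
  insert zero (π ⟨$⟩ʳ zero) (remove zero π) ⟨$⟩ʳ k
    ≡⟨ Perm.insert-remove zero π k ⟩
  π ⟨$⟩ʳ k
    ∎
  where
  open ≡.≡-Reasoning
  r = index n (remove zero π)

index-enumerate : ∀ n i → index n (enumerate n i) ≡ i
index-enumerate zero    zero = ≡.refl
index-enumerate (suc n) i = ≡.trans
  (cong (combine q) (≡.trans (index-cong n (Perm.remove-insert zero q (enumerate n r))) (index-enumerate n r)))
  (combine-remQuot (n !) i)
  where
  q = proj₁ (remQuot (n !) i)
  r = proj₂ (remQuot (n !) i)

⟨$⟩ˡ-cong : ∀ {n} {π ρ : Permutation′ n} → π Perm.≈ ρ → ∀ i → π ⟨$⟩ˡ i ≡ ρ ⟨$⟩ˡ i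
⟨$⟩ˡ-cong {π = π} {ρ} π≈ρ i = ≡.trans (≡.sym (Perm.inverseˡ ρ))
  (cong (ρ ⟨$⟩ˡ_) (≡.trans (≡.sym (π≈ρ (π ⟨$⟩ˡ i))) (Perm.inverseʳ π)))

-- Composition with `π` as a permutation of indices, used to reindex sums over the symmetric group.
translate : ∀ n → Permutation′ n → Permutation′ (n !)
translate n π = Perm.permutation (shift π) (shift (Perm.flip π))
  (shift-shift (Perm.flip π) π (λ _ → Perm.inverseʳ π)) (shift-shift π (Perm.flip π) (λ _ → Perm.inverseˡ π))
  where
  shift : Permutation′ n → Fin (n !) → Fin (n !)
  shift π i = index n (enumerate n i Perm.∘ₚ π)

  shift-shift : ∀ π ρ → (∀ k → ρ ⟨$⟩ʳ (π ⟨$⟩ʳ k) ≡ k) → ∀ i → shift ρ (shift π i) ≡ i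
  shift-shift π ρ inv i = ≡.trans (index-cong n λ k → ≡.trans
    (cong (ρ ⟨$⟩ʳ_) (enumerate-index n (enumerate n i Perm.∘ₚ π) k)) (inv _))
    (index-enumerate n i)

enumerate-translate : ∀ n π i → enumerate n (translate n π ⟨$⟩ʳ i) Perm.≈ (enumerate n i Perm.∘ₚ π)
enumerate-translate n π i = enumerate-index n (enumerate n i Perm.∘ₚ π)

-- Pigeonhole and triangular numbers.

fresh : ∀ {k n} → k ℕ.< n → (f : Fin k → Fin n) → ∃[ t ] ∀ i → t ≢ f i
fresh k<n f with any? (λ t → all? (λ i → ¬? (t ≟ f i)))
... | yes p = p
... | no ¬p = ⊥-elim (<⇒≢ t<t′ (≡.trans (proj₂ (hit _)) (≡.trans (cong f eq) (≡.sym (proj₂ (hit _))))))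
  where
  hit : ∀ t → ∃[ i ] t ≡ f i
  hit t = decidable-stable (any? λ i → t ≟ f i) λ ¬q → ¬p (t , λ i t≡ → ¬q (i , t≡))
  collision = pigeonhole k<n (proj₁ ∘ hit)
  t<t′ = proj₁ (proj₂ (proj₂ collision))
  eq   = proj₂ (proj₂ (proj₂ collision))

-- This is n(n-1)/2; the recursion follows the step in `matching⇒arrangements`.
tri : ℕ → ℕ
tri zero    = zero
tri (suc n) = n ℕ.+ tri n

tri*2 : ∀ n → tri (suc n) ℕ.* 2 ≡ suc n ℕ.* n
tri*2 zero    = ≡.refl
tri*2 (suc n) = begin
  (suc n ℕ.+ tri (suc n)) ℕ.* 2        ≡⟨ ℕ.*-distribʳ-+ 2 (suc n) (tri (suc n)) ⟩
  suc n ℕ.* 2 ℕ.+ tri (suc n) ℕ.* 2    ≡⟨ cong (suc n ℕ.* 2 ℕ.+_) (tri*2 n) ⟩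
  suc n ℕ.* 2 ℕ.+ suc n ℕ.* n          ≡⟨ ℕ.*-distribˡ-+ (suc n) 2 n ⟨
  suc n ℕ.* (2 ℕ.+ n)                  ≡⟨ ℕ.*-comm (suc n) (2 ℕ.+ n) ⟩
  (2 ℕ.+ n) ℕ.* suc n                  ∎
  where open ≡.≡-Reasoning

-- Trades integer division for doubling; the later counts are compared with `d * 2`.
<half⇒*2< : ∀ {d m} → d ℕ.< m ℕ./ 2 → d ℕ.* 2 ℕ.< m
<half⇒*2< {d} {m} d<m/2 = ℕ.<-≤-trans (ℕ.*-monoˡ-< 2 d<m/2) (ℕ.m/n*n≤m m 2)

-- Lower bounds for the number of rearrangements of a vector.

module Arrangement (S : DecSetoid 0ℓ 0ℓ) where
  open DecSetoid S using (Carrier; _≈_) renaming (_≟_ to _≈?_; sym to ≈-sym; trans to ≈-trans; refl to ≈-refl)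

  _≉_ : Carrier → Carrier → Set
  x ≉ y = ¬ (x ≈ y)

  -- Witnesses that the orbit of `g` under permuting its positions has at least `k` elements.
  Arrangements : ∀ {n} → (Fin n → Carrier) → ℕ → Set
  Arrangements {n} g k = Σ (Fin k → Permutation′ n) λ π →
    ∀ i j → (∀ a → g (π i ⟨$⟩ʳ a) ≈ g (π j ⟨$⟩ʳ a)) → i ≡ j

  separate : ∀ {n} (g : Fin n → Carrier) {i j} → g i ≉ g j → ∀ x → x ≉ g i ⊎ x ≉ g j
  separate g {i} {j} gi≉gj x with x ≈? g i
  ... | no  x≉ = inj₁ x≉
  ... | yes x≈ = inj₂ λ x≈gj → gi≉gj (≈-trans (≈-sym x≈) x≈gj)

  ≉⇒≢ : ∀ {n} (g : Fin n → Carrier) {i j} → g i ≉ g j → i ≢ j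
  ≉⇒≢ g gi≉gj ≡.refl = gi≉gj ≈-refl

  removed-≉ : ∀ {n} (g : Fin (suc n) → Carrier) {t i j} (t≢i : t ≢ i) (t≢j : t ≢ j) → g i ≉ g j →
              g (punchIn t (punchOut t≢i)) ≉ g (punchIn t (punchOut t≢j))
  removed-≉ g t≢i t≢j rewrite punchIn-punchOut t≢i | punchIn-punchOut t≢j = λ gi≉gj → gi≉gj

  -- Arrangements with different first values are different.
  arrangements-+ : ∀ {n k l} (g : Fin (suc n) → Carrier) {t u} → g t ≉ g u →
    Arrangements (g ∘ punchIn t) k → Arrangements (g ∘ punchIn u) l → Arrangements g (k ℕ.+ l)
  arrangements-+ {n} {k} {l} g {t} {u} gt≉gu (π , π-inj) (ρ , ρ-inj) =
    τ ∘ splitAt k , λ i j eq → Injection.injective (↔⇒↣ (+↔⊎ {k} {l})) (τ-inj (splitAt k i) (splitAt k j) eq)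
    where
    τ : Fin k ⊎ Fin l → Permutation′ (suc n)
    τ = [ insert zero t ∘ π , insert zero u ∘ ρ ]′

    τ-inj : ∀ x y → (∀ a → g (τ x ⟨$⟩ʳ a) ≈ g (τ y ⟨$⟩ʳ a)) → x ≡ y
    τ-inj (inj₁ i) (inj₁ j) eq = cong inj₁ (π-inj i j (eq ∘ suc))
    τ-inj (inj₁ i) (inj₂ j) eq = contradiction (eq zero) gt≉gu
    τ-inj (inj₂ i) (inj₁ j) eq = contradiction (≈-sym (eq zero)) gt≉gu
    τ-inj (inj₂ i) (inj₂ j) eq = cong inj₂ (ρ-inj i j (eq ∘ suc))

  arrangements-1 : ∀ {n} (g : Fin n → Carrier) → Arrangements g 1
  arrangements-1 g = (λ _ → Perm.id) , λ { zero zero _ → ≡.refl }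

  -- Induction: choose a third position `t`. Its value differs from one of the two given ones; that
  -- one in front gives one arrangement, and `t` in front leaves a nonconstant vector with one
  -- position less.
  nonconstant⇒arrangements : ∀ k (g : Fin (2 ℕ.+ k) → Carrier) {i j} → g i ≉ g j → Arrangements g (2 ℕ.+ k)
  nonconstant⇒arrangements zero g {i} {j} gi≉gj =
    arrangements-+ g gi≉gj (arrangements-1 (g ∘ punchIn i)) (arrangements-1 (g ∘ punchIn j))
  nonconstant⇒arrangements (suc k) g {i} {j} gi≉gj =
    [ (λ gt≉gi → arrangements-+ g (gt≉gi ∘ ≈-sym) (arrangements-1 (g ∘ punchIn i)) rest)
    , (λ gt≉gj → arrangements-+ g (gt≉gj ∘ ≈-sym) (arrangements-1 (g ∘ punchIn j)) rest)
    ]′ (separate g gi≉gj (g t))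
    where
    avoiding = fresh {2} (ℕ.s≤s (ℕ.s≤s (ℕ.s≤s ℕ.z≤n))) (i ∷ j ∷ [])
    t  = proj₁ avoiding
    t≢ = proj₂ avoiding

    rest : Arrangements (g ∘ punchIn t) (2 ℕ.+ k)
    rest = nonconstant⇒arrangements k (g ∘ punchIn t) (removed-≉ g (t≢ 0F) (t≢ 1F) gi≉gj)

  -- Two disjoint edges in the graph that joins positions with different values.
  record Matching {n} (g : Fin n → Carrier) : Set where
    constructor matching
    field
      {p q r s} : Fin n
      gp≉gq : g p ≉ g q
      gr≉gs : g r ≉ g s
      p≢r   : p ≢ r
      p≢s   : p ≢ s
      q≢r   : q ≢ r
      q≢s   : q ≢ s

  -- A fifth position `t` differs in value from `p` or `q`. That one in front leaves the nonconstant
  -- pair `r`, `s` and so one arrangement per remaining position; `t` in front leaves a matching.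
  -- With four positions, `p` and `q` in front give three arrangements each.
  matching⇒arrangements : ∀ k (g : Fin (4 ℕ.+ k) → Carrier) → Matching g → Arrangements g (tri (4 ℕ.+ k))
  matching⇒arrangements zero g (matching {p} {q} gp≉gq gr≉gs p≢r p≢s q≢r q≢s) = arrangements-+ g gp≉gq
    (nonconstant⇒arrangements 1 (g ∘ punchIn p) (removed-≉ g p≢r p≢s gr≉gs))
    (nonconstant⇒arrangements 1 (g ∘ punchIn q) (removed-≉ g q≢r q≢s gr≉gs))
  matching⇒arrangements (suc k) g (matching {p} {q} {r} {s} gp≉gq gr≉gs p≢r p≢s q≢r q≢s) =
    [ (λ gt≉gp → arrangements-+ g (gt≉gp ∘ ≈-sym)
        (nonconstant⇒arrangements (2 ℕ.+ k) (g ∘ punchIn p) (removed-≉ g p≢r p≢s gr≉gs)) rest)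
    , (λ gt≉gq → arrangements-+ g (gt≉gq ∘ ≈-sym)
        (nonconstant⇒arrangements (2 ℕ.+ k) (g ∘ punchIn q) (removed-≉ g q≢r q≢s gr≉gs)) rest)
    ]′ (separate g gp≉gq (g t))
    where
    avoiding = fresh (ℕ.s≤s (ℕ.s≤s (ℕ.s≤s (ℕ.s≤s (ℕ.s≤s (ℕ.z≤n {k})))))) (p ∷ q ∷ r ∷ s ∷ [])
    t  = proj₁ avoiding
    t≢ = proj₂ avoiding

    distinct : ∀ {i j} (t≢i : t ≢ i) (t≢j : t ≢ j) → i ≢ j → punchOut t≢i ≢ punchOut t≢j
    distinct t≢i t≢j i≢j eq = i≢j (≡.trans (≡.sym (punchIn-punchOut t≢i))
      (≡.trans (cong (punchIn t) eq) (punchIn-punchOut t≢j)))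

    rest : Arrangements (g ∘ punchIn t) (tri (4 ℕ.+ k))
    rest = matching⇒arrangements k (g ∘ punchIn t) (matching
      (removed-≉ g (t≢ 0F) (t≢ 1F) gp≉gq) (removed-≉ g (t≢ 2F) (t≢ 3F) gr≉gs)
      (distinct (t≢ 0F) (t≢ 2F) p≢r) (distinct (t≢ 0F) (t≢ 3F) p≢s)
      (distinct (t≢ 1F) (t≢ 2F) q≢r) (distinct (t≢ 1F) (t≢ 3F) q≢s))

  ConstantOff : ∀ {n} → (Fin n → Carrier) → Fin n → Set
  ConstantOff g a = ∀ b c → b ≢ a → c ≢ a → g b ≈ g c

  constantOff? : ∀ {n} (g : Fin n → Carrier) a → ConstantOff g a ⊎ ∃[ b ] ∃[ c ] b ≢ a × c ≢ a × g b ≉ g c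
  constantOff? g a with any? (λ b → any? (λ c → ¬? (b ≟ a) ×-dec ¬? (c ≟ a) ×-dec ¬? (g b ≈? g c)))
  ... | yes (b , c , p) = inj₂ (b , c , p)
  ... | no  ¬p = inj₁ λ b c b≢a c≢a → decidable-stable (g b ≈? g c) λ gb≉gc → ¬p (b , c , b≢a , c≢a , gb≉gc)

  -- Start with an edge between `p` and `q`. If `g` is not constant off `p`, some edge avoids `p`:
  -- it avoids `q` as well, which gives a matching, or it joins `q` to some `r`. In the same way `p`
  -- is joined to some `u`.
  constantOff∨matching : ∀ k (g : Fin (4 ℕ.+ k) → Carrier) → (∃[ a ] ConstantOff g a) ⊎ Matching g
  constantOff∨matching k g with constantOff? g zero
  ... | inj₁ const = inj₁ (zero , const)
  ... | inj₂ (p , q , _ , _ , gp≉gq) with avoid p q gp≉gq | avoid q p (gp≉gq ∘ ≈-sym)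
    where
    avoid : ∀ x y → g x ≉ g y → (∃[ a ] ConstantOff g a) ⊎ Matching g ⊎ ∃[ z ] z ≢ x × g z ≉ g y
    avoid x y gx≉gy with constantOff? g x
    ... | inj₁ const = inj₁ (x , const)
    ... | inj₂ (b , c , b≢x , c≢x , gb≉gc) with b ≟ y | c ≟ y
    ...   | yes ≡.refl | _ = inj₂ (inj₂ (c , c≢x , gb≉gc ∘ ≈-sym))
    ...   | no _ | yes ≡.refl = inj₂ (inj₂ (b , b≢x , gb≉gc))
    ...   | no b≢y | no c≢y = inj₂ (inj₁ (matching gx≉gy gb≉gc (b≢x ∘ ≡.sym) (c≢x ∘ ≡.sym) (b≢y ∘ ≡.sym) (c≢y ∘ ≡.sym)))
  ...   | inj₁ const    | _             = inj₁ const
  ...   | inj₂ (inj₁ M) | _             = inj₂ M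
  ...   | _             | inj₁ const    = inj₁ const
  ...   | _             | inj₂ (inj₁ M) = inj₂ M
  ...   | inj₂ (inj₂ (r , r≢p , gr≉gq)) | inj₂ (inj₂ (u , u≢q , gu≉gp)) with r ≟ u
  ...     | no r≢u = inj₂ (matching gr≉gq gu≉gp r≢u r≢p (u≢q ∘ ≡.sym) (≉⇒≢ g (gp≉gq ∘ ≈-sym)))
  -- The edges form a triangle. A fourth position differs in value from `p` or `q`, and this edge is
  -- disjoint from the opposite side of the triangle.
  ...     | yes ≡.refl with fresh (ℕ.s≤s (ℕ.s≤s (ℕ.s≤s (ℕ.s≤s (ℕ.z≤n {k}))))) (p ∷ q ∷ r ∷ [])
  ...       | t , t≢ with separate g gp≉gq (g t)
  ...         | inj₁ gt≉gp = inj₂ (matching gt≉gp gr≉gq (t≢ 2F) (t≢ 1F) (r≢p ∘ ≡.sym) (≉⇒≢ g gp≉gq))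
  ...         | inj₂ gt≉gq = inj₂ (matching gt≉gq gu≉gp (t≢ 2F) (t≢ 0F) (u≢q ∘ ≡.sym) (≉⇒≢ g (gp≉gq ∘ ≈-sym)))

-- A commutative ring solver with integer coefficients.

module RingSolver {c ℓ} (R : CommutativeRing c ℓ) where
  open CommutativeRing R hiding (zero)
  open Algebra.Properties.Ring ring using (x[y-z]≈xy-xz; [y-z]x≈yx-zx)
  open Algebra.Properties.AbelianGroup +-abelianGroup using (⁻¹-∙-comm; ⁻¹-involutive; ⁻¹-anti-homo-∙)
  open Algebra.Properties.CommutativeSemigroup +-commutativeSemigroup using (interchange)
  open Algebra.Properties.Semiring.Mult semiring using (×-homo-+; ×1-homo-*) renaming (_×_ to _×#_)
  open Relation.Binary.Reasoning.Setoid setoid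

  difference : ℕ × ℕ → Carrier
  difference (a , b) = a ×# 1# - b ×# 1#

  difference-+ : ∀ w x y z → (w + y) - (x + z) ≈ (w - x) + (y - z)
  difference-+ w x y z = trans (+-congˡ (sym (⁻¹-∙-comm x z))) (interchange w y (- x) (- z))

  difference-neg : ∀ x y → y - x ≈ - (x - y)
  difference-neg x y = begin
    y - x          ≈⟨ +-congʳ (⁻¹-involutive y) ⟨
    - (- y) - x    ≈⟨ ⁻¹-anti-homo-∙ x (- y) ⟨
    - (x - y)      ∎

  difference-* : ∀ w x y z → (w * y + x * z) - (w * z + x * y) ≈ (w - x) * (y - z)
  difference-* w x y z = begin
    (w * y + x * z) - (w * z + x * y)    ≈⟨ difference-+ (w * y) (w * z) (x * z) (x * y) ⟩
    (w * y - w * z) + (x * z - x * y)    ≈⟨ +-congˡ (difference-neg (x * y) (x * z)) ⟩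
    (w * y - w * z) - (x * y - x * z)    ≈⟨ +-cong (x[y-z]≈xy-xz w y z) (-‿cong (x[y-z]≈xy-xz x y z)) ⟨
    w * (y - z) - x * (y - z)            ≈⟨ [y-z]x≈yx-zx (y - z) w x ⟨
    (w - x) * (y - z)                    ∎

  -- Normal form with a zero component, so that equal integers become identical pairs and
  -- `weaklyEqual` recognises them.
  reduce : ℕ × ℕ → ℕ × ℕ
  reduce (suc a , suc b) = reduce (a , b)
  reduce x               = x

  difference-reduce : ∀ x → difference (reduce x) ≈ difference x
  difference-reduce (zero  , b)     = refl
  difference-reduce (suc a , zero)  = refl
  difference-reduce (suc a , suc b) = begin
    difference (reduce (a , b))          ≈⟨ difference-reduce (a , b) ⟩
    difference (a , b)                   ≈⟨ +-identityˡ _ ⟨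
    0# + difference (a , b)              ≈⟨ +-congʳ (-‿inverseʳ 1#) ⟨
    (1# - 1#) + difference (a , b)       ≈⟨ difference-+ 1# 1# _ _ ⟨
    difference (suc a , suc b)           ∎

  -- The first two clauses make the constants 0 and 1 of the solver denote 0# and 1# on the nose.
  ⟦_⟧ : ℕ × ℕ → Carrier
  ⟦ 0 , 0 ⟧ = 0#
  ⟦ 1 , 0 ⟧ = 1#
  ⟦ x ⟧     = difference x

  ⟦⟧-difference : ∀ x → ⟦ x ⟧ ≈ difference x
  ⟦⟧-difference (0 , 0)           = sym (-‿inverseʳ 0#)
  ⟦⟧-difference (1 , 0)           = sym (trans (+-assoc _ _ _) (trans (+-congˡ (-‿inverseʳ 0#)) (+-identityʳ 1#)))
  ⟦⟧-difference (0 , suc b)       = refl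
  ⟦⟧-difference (1 , suc b)       = refl
  ⟦⟧-difference (suc (suc a) , b) = refl

  ⟦reduce⟧ : ∀ x → ⟦ reduce x ⟧ ≈ difference x
  ⟦reduce⟧ x = trans (⟦⟧-difference (reduce x)) (difference-reduce x)

  -- A pair (m , n) stands for the integer m - n.
  differences : RawRing _ _
  differences = record
    { Carrier = ℕ × ℕ
    ; _≈_     = _≡_
    ; _+_     = λ (a , b) (c , d) → reduce (a ℕ.+ c , b ℕ.+ d)
    ; _*_     = λ (a , b) (c , d) → reduce (a ℕ.* c ℕ.+ b ℕ.* d , a ℕ.* d ℕ.+ b ℕ.* c)
    ; -_      = λ (a , b) → b , a
    ; 0#      = 0 , 0
    ; 1#      = 1 , 0
    }

  homomorphism : differences -Raw-AlmostCommutative⟶ fromCommutativeRing R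
  homomorphism = record
    { ⟦_⟧    = ⟦_⟧
    ; +-homo = λ x@(a , b) y@(c , d) → trans (⟦reduce⟧ (a ℕ.+ c , b ℕ.+ d)) (trans
        (+-cong (×-homo-+ 1# a c) (-‿cong (×-homo-+ 1# b d)))
        (trans (difference-+ _ _ _ _) (sym (+-cong (⟦⟧-difference x) (⟦⟧-difference y)))))
    ; *-homo = λ x@(a , b) y@(c , d) → trans (⟦reduce⟧ (a ℕ.* c ℕ.+ b ℕ.* d , a ℕ.* d ℕ.+ b ℕ.* c)) (trans
        (+-cong (×-homo-+* a c b d) (-‿cong (×-homo-+* a d b c)))
        (trans (difference-* _ _ _ _) (sym (*-cong (⟦⟧-difference x) (⟦⟧-difference y)))))
    ; -‿homo = λ x@(a , b) → trans (⟦⟧-difference (b , a))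
        (trans (difference-neg _ _) (-‿cong (sym (⟦⟧-difference x))))
    ; 0-homo = refl
    ; 1-homo = refl
    }
    where
    ×-homo-+* : ∀ a b c d → (a ℕ.* b ℕ.+ c ℕ.* d) ×# 1# ≈ a ×# 1# * b ×# 1# + c ×# 1# * d ×# 1#
    ×-homo-+* a b c d = trans (×-homo-+ 1# (a ℕ.* b) (c ℕ.* d)) (+-cong (×1-homo-* a b) (×1-homo-* c d))

  weaklyEqual : ∀ (x y : ℕ × ℕ) → Maybe (⟦ x ⟧ ≈ ⟦ y ⟧)
  weaklyEqual x y with ≡-dec ℕ._≟_ ℕ._≟_ x y
  ... | yes eq = just (reflexive (cong ⟦_⟧ eq))
  ... | no  _  = nothing

  open Algebra.Solver.Ring differences (fromCommutativeRing R) homomorphism weaklyEqual public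
    using (solve; _:=_; _:+_; _:*_; _:-_; :-_; con)

-- Ordered field arithmetic and finite sums.

module OrderedField (ℝ : Reals) where
  open Reals ℝ hiding (zero)
  open IsDecTotalOrder isDecTotalOrder public
    using (antisym; total; ≤-respˡ-≈; ≤-respʳ-≈)
    renaming (_≟_ to _≈?_; reflexive to ≤-reflexive; trans to ≤-trans; refl to ≤-refl)
  open RingSolver commutativeRing public using (solve; _:=_; _:+_; _:*_; _:-_; :-_; con)
  open Algebra.Properties.Semiring.Sum semiring public
    using (sum; sum-cong-≋; ∑-distrib-+; ∑-comm; sum-permute; sum-remove; sum-replicate-zero;
           *-distribˡ-sum; *-distribʳ-sum)
  open Algebra.Properties.Semiring.Mult semiring public using () renaming (_×_ to _×#_)
  open Relation.Binary.Reasoning.Setoid setoid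

  ≤⇒0≤- : ∀ {x y} → x ≤ y → 0# ≤ y - x
  ≤⇒0≤- {x} x≤y = ≤-respˡ-≈ (-‿inverseʳ x) (+-monoˡ-≤ (- x) x≤y)

  0≤-⇒≤ : ∀ {x y} → 0# ≤ y - x → x ≤ y
  0≤-⇒≤ {x} {y} 0≤y-x = ≤-respˡ-≈ (+-identityˡ x)
    (≤-respʳ-≈ (solve 2 (λ x y → y :- x :+ x := y) refl x y) (+-monoˡ-≤ x 0≤y-x))

  +-nonneg : ∀ {x y} → 0# ≤ x → 0# ≤ y → 0# ≤ x + y
  +-nonneg {x} {y} 0≤x 0≤y = ≤-trans 0≤y (≤-respˡ-≈ (+-identityˡ y) (+-monoˡ-≤ y 0≤x))

  nonneg-total : ∀ x → 0# ≤ x ⊎ 0# ≤ - x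
  nonneg-total x with total 0# x
  ... | inj₁ 0≤x = inj₁ 0≤x
  ... | inj₂ x≤0 = inj₂ (≤-respʳ-≈ (+-identityˡ (- x)) (≤⇒0≤- x≤0))

  nonneg-antisym : ∀ {x} → 0# ≤ x → 0# ≤ - x → x ≈ 0#
  nonneg-antisym {x} 0≤x 0≤-x =
    antisym (0≤-⇒≤ (≤-respʳ-≈ (sym (+-identityˡ (- x))) 0≤-x)) 0≤x

  0≤1 : 0# ≤ 1#
  0≤1 with nonneg-total 1#
  ... | inj₁ 0≤1  = 0≤1
  ... | inj₂ 0≤-1 = ≤-respʳ-≈ (solve 0 (:- con (1 , 0) :* :- con (1 , 0) := con (1 , 0)) refl) (*-nonneg 0≤-1 0≤-1)

  1≉0 : ¬ (1# ≈ 0#)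
  1≉0 1≈0 = 0≉1 (sym 1≈0)

  +≈0⇒≈0 : ∀ {x y} → 0# ≤ x → 0# ≤ y → x + y ≈ 0# → x ≈ 0#
  +≈0⇒≈0 {x} {y} 0≤x 0≤y x+y≈0 = nonneg-antisym 0≤x (≤-respʳ-≈ (begin
    y            ≈⟨ solve 2 (λ x y → y := (x :+ y) :- x) refl x y ⟩
    (x + y) - x  ≈⟨ +-congʳ x+y≈0 ⟩
    0# - x       ≈⟨ +-identityˡ (- x) ⟩
    - x          ∎) 0≤y)

  *≈0⇒≈0 : ∀ {x y} → ¬ (x ≈ 0#) → x * y ≈ 0# → y ≈ 0#
  *≈0⇒≈0 {x} {y} x≉0 xy≈0 with inverse x x≉0
  ... | z , xz≈1 = begin
    y            ≈⟨ *-identityˡ y ⟨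
    1# * y       ≈⟨ *-congʳ xz≈1 ⟨
    x * z * y    ≈⟨ solve 3 (λ x y z → x :* z :* y := z :* (x :* y)) refl x y z ⟩
    z * (x * y)  ≈⟨ *-congˡ xy≈0 ⟩
    z * 0#       ≈⟨ zeroʳ z ⟩
    0#           ∎

  *≉0 : ∀ {x y} → ¬ (x ≈ 0#) → ¬ (y ≈ 0#) → ¬ (x * y ≈ 0#)
  *≉0 x≉0 y≉0 xy≈0 = y≉0 (*≈0⇒≈0 x≉0 xy≈0)

  inverse-nonneg : ∀ {x y} → 0# ≤ x → x * y ≈ 1# → 0# ≤ y
  inverse-nonneg {x} {y} 0≤x xy≈1 with nonneg-total y
  ... | inj₁ 0≤y  = 0≤y
  ... | inj₂ 0≤-y = contradiction (nonneg-antisym 0≤1 (≤-respʳ-≈ (begin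
    x * - y    ≈⟨ solve 2 (λ x y → x :* :- y := :- (x :* y)) refl x y ⟩
    - (x * y)  ≈⟨ -‿cong xy≈1 ⟩
    - 1#       ∎) (*-nonneg 0≤x 0≤-y))) 1≉0

  sum-nonneg : ∀ {n} (f : Vector Carrier n) → (∀ i → 0# ≤ f i) → 0# ≤ sum f
  sum-nonneg {zero}  f 0≤f = ≤-refl
  sum-nonneg {suc n} f 0≤f = +-nonneg (0≤f zero) (sum-nonneg (f ∘ suc) (0≤f ∘ suc))

  sum-bounds-term : ∀ {n} (f : Vector Carrier n) → (∀ i → 0# ≤ f i) → ∀ i → 0# ≤ sum f - f i
  sum-bounds-term {suc n} f 0≤f i = ≤-respʳ-≈
    (trans (solve 2 (λ x y → y := x :+ y :- x) refl (f i) _) (+-congʳ (sym (sum-remove {i = i} f))))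
    (sum-nonneg (removeAt f i) λ k → 0≤f (punchIn i k))

  sum≈0⇒≈0 : ∀ {n} (f : Vector Carrier n) → (∀ i → 0# ≤ f i) → sum f ≈ 0# → ∀ i → f i ≈ 0#
  sum≈0⇒≈0 f 0≤f sum≈0 i = nonneg-antisym (0≤f i) (≤-respʳ-≈
    (trans (+-congʳ sum≈0) (+-identityˡ (- f i))) (sum-bounds-term f 0≤f i))

  ×#-nonneg : ∀ k → 0# ≤ k ×# 1#
  ×#-nonneg zero    = ≤-refl
  ×#-nonneg (suc k) = +-nonneg 0≤1 (×#-nonneg k)

  ×#-mono : ∀ {k l} → k ℕ.≤ l → 0# ≤ l ×# 1# - k ×# 1#
  ×#-mono {_} {l} ℕ.z≤n = ≤-respʳ-≈ (solve 1 (λ x → x := x :- con (0 , 0)) refl (l ×# 1#)) (×#-nonneg l)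
  ×#-mono {suc k} {suc l} (ℕ.s≤s k≤l) = ≤-respʳ-≈
    (solve 2 (λ x y → y :- x := (con (1 , 0) :+ y) :- (con (1 , 0) :+ x)) refl (k ×# 1#) (l ×# 1#)) (×#-mono k≤l)

  suc×#≉0 : ∀ k → ¬ (suc k ×# 1# ≈ 0#)
  suc×#≉0 k eq = 1≉0 (+≈0⇒≈0 0≤1 (×#-nonneg k) eq)

  sum-const : ∀ n x → sum {n} (λ _ → x) ≈ n ×# 1# * x
  sum-const zero    x = sym (zeroˡ x)
  sum-const (suc n) x = trans (+-congˡ (sum-const n x))
    (solve 2 (λ x k → x :+ k :* x := (con (1 , 0) :+ k) :* x) refl x (n ×# 1#))

  sum-linear₂ : ∀ {n} (x y : Carrier) (f g : Vector Carrier n) →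
                sum (λ i → x * f i + y * g i) ≈ x * sum f + y * sum g
  sum-linear₂ x y f g = trans (∑-distrib-+ (λ i → x * f i) (λ i → y * g i))
    (sym (+-cong (*-distribˡ-sum x f) (*-distribˡ-sum y g)))

  indicator : Bool → Carrier
  indicator b = if b then 1# else 0#

  indicator-nonneg : ∀ b → 0# ≤ indicator b
  indicator-nonneg true  = 0≤1
  indicator-nonneg false = ≤-refl

  δ : ∀ {n} → Fin n → Fin n → Carrier
  δ i j = indicator (does (i ≟ j))

  sum-δ : ∀ {n} (a : Fin n) (f : Vector Carrier n) → sum (λ i → δ a i * f i) ≈ f a
  sum-δ {suc n} zero f = begin
    1# * f zero + sum (λ i → 0# * f (suc i))  ≈⟨ +-cong (*-identityˡ _) (sum-cong-≋ λ i → zeroˡ (f (suc i))) ⟩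
    f zero + sum {n} (λ _ → 0#)               ≈⟨ +-congˡ (sum-replicate-zero n) ⟩
    f zero + 0#                               ≈⟨ +-identityʳ _ ⟩
    f zero                                    ∎
  sum-δ (suc a) f = trans (+-congʳ (zeroˡ (f zero))) (trans (+-identityˡ _) (sum-δ a (f ∘ suc)))

  -- Adding A₀ over all instances gives one scale that works for each of them.
  dominating : ∀ {x y} → 0# ≤ x → 0# ≤ y → (x ≈ 0# → y ≈ 0#) →
               ∃[ A₀ ] 0# ≤ A₀ × (∀ A → 0# ≤ A - A₀ → 0# ≤ A * x - y)
  dominating {x} {y} 0≤x 0≤y x≈0⇒y≈0 with x ≈? 0#
  ... | yes x≈0 = 0# , ≤-refl , λ A _ → ≤-reflexive (begin
    0#              ≈⟨ solve 1 (λ A → con (0 , 0) := A :* con (0 , 0) :- con (0 , 0)) refl A ⟩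
    A * 0# - 0#     ≈⟨ +-cong (*-congˡ x≈0) (-‿cong (x≈0⇒y≈0 x≈0)) ⟨
    A * x - y       ∎)
  ... | no x≉0 with inverse x x≉0
  -- The scale is y / x, since (A - y / x) x = A x - y.
  ...   | z , xz≈1 = y * z , *-nonneg 0≤y (inverse-nonneg 0≤x xz≈1) , λ A 0≤A-yz → ≤-respʳ-≈ (begin
    (A - y * z) * x       ≈⟨ solve 4 (λ A x y z → (A :- y :* z) :* x := A :* x :- y :* (x :* z)) refl A x y z ⟩
    A * x - y * (x * z)   ≈⟨ +-congˡ (-‿cong (trans (*-congˡ xz≈1) (*-identityʳ y))) ⟩
    A * x - y             ∎) (*-nonneg 0≤A-yz 0≤x)

does-≟-cong : ∀ {m n} {i j : Fin m} {k l : Fin n} → (i ≡ j → k ≡ l) → (k ≡ l → i ≡ j) →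
         does (i ≟ j) ≡ does (k ≟ l)
does-≟-cong {i = i} {j} {k} {l} to from with i ≟ j
... | yes i≡j = ≡.sym (dec-true (k ≟ l) (to i≡j))
... | no  i≢j = ≡.sym (dec-false (k ≟ l) (i≢j ∘ from))

-- Sums over the symmetric group and their position-value matrices.

module Averages (ℝ : Reals) where
  open Reals ℝ hiding (zero)
  open OrderedField ℝ
  open Relation.Binary.Reasoning.Setoid setoid

  Matrix : ℕ → Set
  Matrix n = Fin n → Fin n → Carrier

  EqualRowsOff : ∀ {n} → Matrix n → Fin n → Set
  EqualRowsOff F a = ∀ b c → b ≢ a → c ≢ a → ∀ v → F b v ≈ F c v

  module _ {k} {D F : Matrix (2 ℕ.+ k)} {ρ t : Carrier}
    (D-rows : ∀ a → sum (D a) ≈ ρ) (D-columns : ∀ v → sum (λ a → D a v) ≈ ρ)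
    (F-rows : ∀ a → sum (F a) ≈ t) (F-columns : ∀ v → sum (λ a → F a v) ≈ t)
    {a : Fin (2 ℕ.+ k)} (F-off : EqualRowsOff F a)
    where
    private
      n = 2 ℕ.+ k
      ν₁ = suc k ×# 1#

      ψ : Fin n → Carrier
      ψ = F (punchIn a zero)

      D₁ : Fin n → Carrier
      D₁ v = sum λ i → D (punchIn a i) v

    -- Split each column at row `a`. Off that row `F` has the single value `ψ v`, taken `ν₁` times,
    -- so the claim is a polynomial identity in `D a v`, `D₁ v`, `F a v` and `ψ v`.
    entrySum-column : ∀ v → ν₁ * sum (λ b → D b v * F b v) + (ρ * F a v + t * D a v) ≈
                            (1# + ν₁) * (D a v * F a v) + ρ * t
    entrySum-column v = begin
      ν₁ * sum (λ b → D b v * F b v) + (ρ * F a v + t * D a v)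
        ≈⟨ +-cong (*-congˡ split-DF) (+-cong (*-congʳ split-ρ) (*-congʳ split-t)) ⟩
      ν₁ * (D a v * F a v + D₁ v * ψ v) + ((D a v + D₁ v) * F a v + (F a v + ν₁ * ψ v) * D a v)
        ≈⟨ solve 5 (λ c x y f g → c :* (x :* f :+ y :* g) :+ ((x :+ y) :* f :+ (f :+ c :* g) :* x)
             := (con (1 , 0) :+ c) :* (x :* f) :+ (x :+ y) :* (f :+ c :* g)) refl ν₁ (D a v) (D₁ v) (F a v) (ψ v) ⟩
      (1# + ν₁) * (D a v * F a v) + (D a v + D₁ v) * (F a v + ν₁ * ψ v)
        ≈⟨ +-congˡ (*-cong split-ρ split-t) ⟨
      (1# + ν₁) * (D a v * F a v) + ρ * t
        ∎
      where
      rest : ∀ i → F (punchIn a i) v ≈ ψ v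
      rest i = F-off _ _ (punchInᵢ≢i a i) (punchInᵢ≢i a zero) v

      split-ρ : ρ ≈ D a v + D₁ v
      split-ρ = trans (sym (D-columns v)) (sum-remove {i = a} λ b → D b v)

      split-t : t ≈ F a v + ν₁ * ψ v
      split-t = trans (sym (F-columns v)) (trans (sum-remove {i = a} λ b → F b v)
        (+-congˡ (trans (sum-cong-≋ rest) (sum-const (suc k) (ψ v)))))

      split-DF : sum (λ b → D b v * F b v) ≈ D a v * F a v + D₁ v * ψ v
      split-DF = trans (sum-remove {i = a} λ b → D b v * F b v) (+-congˡ (trans
        (sum-cong-≋ λ i → *-congˡ {x = D (punchIn a i) v} (rest i)) (sym (*-distribʳ-sum (ψ v) λ i → D (punchIn a i) v))))

    -- Summing the column identity over the n = 1 + ν₁ columns, the row sums turn each of the two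
    -- correction terms into ρ t; against n ρ t on the other side, (ν₁ - 1) ρ t remains.
    entrySum : ν₁ * sum (λ v → sum (λ b → D b v * F b v)) - (ν₁ - 1#) * ρ * t ≈
               (1# + ν₁) * sum (λ v → D a v * F a v)
    entrySum = begin
      ν₁ * Σ′ - (ν₁ - 1#) * ρ * t
        ≈⟨ solve 4 (λ c s ρ t → c :* s :- (c :- con (1 , 0)) :* ρ :* t :=
             c :* s :+ (ρ :* t :+ t :* ρ) :- (con (1 , 0) :+ c) :* (ρ :* t)) refl ν₁ Σ′ ρ t ⟩
      ν₁ * Σ′ + (ρ * t + t * ρ) - (1# + ν₁) * (ρ * t)
        ≈⟨ +-congʳ summed ⟩
      (1# + ν₁) * E + (1# + ν₁) * (ρ * t) - (1# + ν₁) * (ρ * t)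
        ≈⟨ solve 2 (λ x y → x :+ y :- y := x) refl ((1# + ν₁) * E) ((1# + ν₁) * (ρ * t)) ⟩
      (1# + ν₁) * E
        ∎
      where
      column : Fin n → Carrier
      column v = sum λ b → D b v * F b v
      Σ′ = sum column
      E  = sum λ v → D a v * F a v

      summed : ν₁ * Σ′ + (ρ * t + t * ρ) ≈ (1# + ν₁) * E + (1# + ν₁) * (ρ * t)
      summed = begin
        ν₁ * Σ′ + (ρ * t + t * ρ)
          ≈⟨ +-congˡ (+-cong (*-congˡ (F-rows a)) (*-congˡ (D-rows a))) ⟨
        ν₁ * Σ′ + (ρ * sum (F a) + t * sum (D a))
          ≈⟨ +-cong (*-distribˡ-sum ν₁ column) (sym (sum-linear₂ ρ t (F a) (D a))) ⟩
        sum (λ v → ν₁ * column v) + sum (λ v → ρ * F a v + t * D a v)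
          ≈⟨ ∑-distrib-+ (λ v → ν₁ * column v) (λ v → ρ * F a v + t * D a v) ⟨
        sum (λ v → ν₁ * column v + (ρ * F a v + t * D a v))
          ≈⟨ sum-cong-≋ entrySum-column ⟩
        sum (λ v → (1# + ν₁) * (D a v * F a v) + ρ * t)
          ≈⟨ ∑-distrib-+ (λ v → (1# + ν₁) * (D a v * F a v)) (λ _ → ρ * t) ⟩
        sum (λ v → (1# + ν₁) * (D a v * F a v)) + sum {n} (λ _ → ρ * t)
          ≈⟨ +-cong (sym (*-distribˡ-sum (1# + ν₁) λ v → D a v * F a v)) (sum-const n (ρ * t)) ⟩
        (1# + ν₁) * E + (1# + ν₁) * (ρ * t)
          ∎

  δ-transpose : ∀ {n} (ζ : Permutation′ n) v a → δ (ζ ⟨$⟩ʳ v) a ≈ δ (ζ ⟨$⟩ˡ a) v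
  δ-transpose ζ v a = reflexive (cong indicator (does-≟-cong
    (λ eq → ≡.trans (cong (ζ ⟨$⟩ˡ_) (≡.sym eq)) (Perm.inverseˡ ζ))
    (λ eq → ≡.trans (cong (ζ ⟨$⟩ʳ_) (≡.sym eq)) (Perm.inverseʳ ζ))))

  δ-permute : ∀ {n} (π : Permutation′ n) i j → δ (π ⟨$⟩ʳ i) (π ⟨$⟩ʳ j) ≈ δ i j
  δ-permute π i j = reflexive (cong indicator (does-≟-cong
    (λ eq → ≡.trans (≡.sym (Perm.inverseˡ π)) (≡.trans (cong (π ⟨$⟩ˡ_) eq) (Perm.inverseˡ π)))
    (cong (π ⟨$⟩ʳ_))))

  module _ {n : ℕ} where

    Respectful : (Permutation′ n → Carrier) → Set
    Respectful h = ∀ {π ρ} → π Perm.≈ ρ → h π ≈ h ρ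

    ∑ₚ : (Permutation′ n → Carrier) → Carrier
    ∑ₚ h = sum λ i → h (enumerate n i)

    -- The vertex given by ζ has the coordinate number v at position a exactly if ζ maps v to a.
    T : (Permutation′ n → Carrier) → Matrix n
    T h a v = ∑ₚ λ ζ → δ (ζ ⟨$⟩ʳ v) a * h ζ

    ∑ₚ-translate : ∀ {h} → Respectful h → ∀ π → ∑ₚ h ≈ ∑ₚ (λ ζ → h (ζ Perm.∘ₚ π))
    ∑ₚ-translate {h} h-resp π = trans (sum-permute (h ∘ enumerate n) (translate n π))
      (sum-cong-≋ λ i → h-resp (enumerate-translate n π i))

    T-cong : ∀ {g h} → (∀ ζ → g ζ ≈ h ζ) → ∀ a v → T g a v ≈ T h a v
    T-cong g≈h a v = sum-cong-≋ λ i → *-congˡ (g≈h (enumerate n i))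

    T-nonneg : ∀ {h} → (∀ ζ → 0# ≤ h ζ) → ∀ a v → 0# ≤ T h a v
    T-nonneg 0≤h a v = sum-nonneg _ λ i →
      *-nonneg (indicator-nonneg (does (enumerate n i ⟨$⟩ʳ v ≟ a))) (0≤h (enumerate n i))

    -- Each permutation contributes to exactly one entry of a column and, in `T-rows`, of a row; all
    -- line sums therefore agree.
    T-columns : ∀ h v → sum (λ a → T h a v) ≈ ∑ₚ h
    T-columns h v = trans (∑-comm λ a i → δ (enumerate n i ⟨$⟩ʳ v) a * h (enumerate n i))
      (sum-cong-≋ λ i → sum-δ (enumerate n i ⟨$⟩ʳ v) λ _ → h (enumerate n i))

    T-rows : ∀ h a → sum (T h a) ≈ ∑ₚ h
    T-rows h a = trans (∑-comm λ v i → δ (enumerate n i ⟨$⟩ʳ v) a * h (enumerate n i))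
      (sum-cong-≋ λ i → trans
        (sum-cong-≋ {n} λ v → *-congʳ (δ-transpose (enumerate n i) v a))
        (sum-δ (enumerate n i ⟨$⟩ˡ a) λ _ → h (enumerate n i)))

    T-translate : ∀ {h} → Respectful h → ∀ π a v → T h (π ⟨$⟩ʳ a) v ≈ T (λ ζ → h (ζ Perm.∘ₚ π)) a v
    T-translate {h} h-resp π a v = trans
      (∑ₚ-translate {λ ζ → δ (ζ ⟨$⟩ʳ v) (π ⟨$⟩ʳ a) * h ζ}
        (λ π≈ρ → *-cong (reflexive (cong (λ b → δ b (π ⟨$⟩ʳ a)) (π≈ρ v))) (h-resp π≈ρ)) π)
      (sum-cong-≋ {n !} λ i → *-congʳ (δ-permute π (enumerate n i ⟨$⟩ʳ v) a))

    -- Both sides pair `D` with the permutation matrices, weighted by `h`.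
    diagonalSum : ∀ (D : Matrix n) h → ∑ₚ (λ ζ → sum (λ v → D (ζ ⟨$⟩ʳ v) v) * h ζ) ≈
                          sum (λ v → sum (λ a → D a v * T h a v))
    diagonalSum D h = sym (begin
      sum (λ v → sum (λ a → D a v * T h a v))
        ≈⟨ sum-cong-≋ (λ v → sum-cong-≋ λ a → *-distribˡ-sum (D a v) (λ i → δ (e i ⟨$⟩ʳ v) a * h (e i))) ⟩
      sum (λ v → sum (λ a → sum (λ i → D a v * (δ (e i ⟨$⟩ʳ v) a * h (e i)))))
        ≈⟨ sum-cong-≋ (λ v → ∑-comm λ a i → D a v * (δ (e i ⟨$⟩ʳ v) a * h (e i))) ⟩
      sum (λ v → sum (λ i → sum (λ a → D a v * (δ (e i ⟨$⟩ʳ v) a * h (e i)))))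
        ≈⟨ sum-cong-≋ (λ v → sum-cong-≋ λ i → trans
             (sum-cong-≋ λ a → solve 3 (λ x y z → x :* (y :* z) := y :* (x :* z)) refl (D a v) (δ (e i ⟨$⟩ʳ v) a) (h (e i)))
             (sum-δ (e i ⟨$⟩ʳ v) λ a → D a v * h (e i))) ⟩
      sum (λ v → sum (λ i → D (e i ⟨$⟩ʳ v) v * h (e i)))
        ≈⟨ ∑-comm (λ v i → D (e i ⟨$⟩ʳ v) v * h (e i)) ⟩
      sum (λ i → sum (λ v → D (e i ⟨$⟩ʳ v) v * h (e i)))
        ≈⟨ sum-cong-≋ (λ i → *-distribʳ-sum (h (e i)) λ v → D (e i ⟨$⟩ʳ v) v) ⟨
      ∑ₚ (λ ζ → sum (λ v → D (ζ ⟨$⟩ʳ v) v) * h ζ)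
        ∎)
      where e = enumerate n

  module _ {k} (D : Matrix (2 ℕ.+ k)) (ρ : Carrier) where
    private
      n = 2 ℕ.+ k
      ν₁ = suc k ×# 1#

    -- Signed weights; if all lines of `D` sum to `ρ`, the permutation matrices with these weights
    -- add up to n! times `D`. The coefficients are those of `entrySum`.
    weight : Permutation′ n → Carrier
    weight ζ = ν₁ * sum (λ v → D (ζ ⟨$⟩ʳ v) v) - (ν₁ - 1#) * ρ

    -- The two constants in the weight cancel everything except row a.
    weightedSum : (∀ a → sum (D a) ≈ ρ) → (∀ v → sum (λ a → D a v) ≈ ρ) →
                  ∀ h {a} → EqualRowsOff (T h) a →
                  ∑ₚ (λ ζ → weight ζ * h ζ) ≈ (1# + ν₁) * sum (λ v → D a v * T h a v)
    weightedSum D-rows D-columns h {a} off = begin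
      ∑ₚ (λ ζ → weight ζ * h ζ)
        ≈⟨ sum-cong-≋ (λ i → solve 4 (λ c x r y → (c :* x :- r) :* y := c :* (x :* y) :+ (:- r) :* y) refl
             ν₁ (sum (λ v → D (enumerate n i ⟨$⟩ʳ v) v)) ((ν₁ - 1#) * ρ) (h (enumerate n i))) ⟩
      ∑ₚ (λ ζ → ν₁ * (sum (λ v → D (ζ ⟨$⟩ʳ v) v) * h ζ) + (- ((ν₁ - 1#) * ρ)) * h ζ)
        ≈⟨ sum-linear₂ ν₁ (- ((ν₁ - 1#) * ρ)) (λ i → sum (λ v → D (enumerate n i ⟨$⟩ʳ v) v) * h (enumerate n i)) (h ∘ enumerate n) ⟩
      ν₁ * ∑ₚ (λ ζ → sum (λ v → D (ζ ⟨$⟩ʳ v) v) * h ζ) + (- ((ν₁ - 1#) * ρ)) * ∑ₚ h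
        ≈⟨ +-cong (*-congˡ (diagonalSum D h)) (solve 2 (λ x y → (:- x) :* y := :- (x :* y)) refl ((ν₁ - 1#) * ρ) (∑ₚ h)) ⟩
      ν₁ * sum (λ v → sum (λ b → D b v * T h b v)) - (ν₁ - 1#) * ρ * ∑ₚ h
        ≈⟨ entrySum {D = D} {F = T h} D-rows D-columns (T-rows h) (T-columns h) off ⟩
      (1# + ν₁) * sum (λ v → D a v * T h a v)
        ∎

-- Matrices crossing a facet, and the rows that obstruct them.

module Thresholds (ℝ : Reals) where
  open Reals ℝ hiding (zero)
  open OrderedField ℝ
  open Averages ℝ
  open Relation.Binary.Reasoning.Setoid setoid

  indicator-+-not : ∀ b → indicator b + indicator (not b) ≈ 1#
  indicator-+-not true  = +-identityʳ 1#
  indicator-+-not false = +-identityˡ 1#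

  sum-combination : ∀ {n} (p q r s : Carrier) (X Y Z W : Vector Carrier n) →
    sum (λ i → (p * X i + q * Y i) + (r * Z i + s * W i)) ≈ (p * sum X + q * sum Y) + (r * sum Z + s * sum W)
  sum-combination p q r s X Y Z W = trans
    (∑-distrib-+ (λ i → p * X i + q * Y i) (λ i → r * Z i + s * W i))
    (+-cong (sum-linear₂ p q X Y) (sum-linear₂ r s Z W))

  zeroImplies? : ∀ x y → (x ≈ 0# → y ≈ 0#) ⊎ (x ≈ 0# × ¬ (y ≈ 0#))
  zeroImplies? x y with x ≈? 0# | y ≈? 0#
  ... | no x≉0  | _       = inj₁ λ x≈0 → contradiction x≈0 x≉0
  ... | yes _   | yes y≈0 = inj₁ λ _ → y≈0
  ... | yes x≈0 | no y≉0  = inj₂ (x≈0 , y≉0)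

  module Threshold {k} (m : Fin k) where

    -- Numbering is 0-based: the cut `m` has toℕ m + 1 indices below it, and `Fin k` lists all cuts
    -- with both sides nonempty. The same cut serves for positions and for values.
    below : Fin (suc k) → Bool
    below v = does (toℕ v ℕ.≤? toℕ m)

    lo hi : Fin (suc k) → Carrier
    lo v = indicator (below v)
    hi v = indicator (not (below v))

    below-true : ∀ {v} → toℕ v ℕ.≤ toℕ m → below v ≡ true
    below-true {v} = dec-true (toℕ v ℕ.≤? toℕ m)

    below-false : ∀ {v} → toℕ m ℕ.< toℕ v → below v ≡ false
    below-false {v} m<v = dec-false (toℕ v ℕ.≤? toℕ m) (ℕ.<⇒≱ m<v)

    lo≈1 : ∀ {v} → toℕ v ℕ.≤ toℕ m → lo v ≈ 1#
    lo≈1 v≤m = reflexive (cong indicator (below-true v≤m))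

    hi≈1 : ∀ {v} → toℕ m ℕ.< toℕ v → hi v ≈ 1#
    hi≈1 m<v = reflexive (cong (indicator ∘ not) (below-false m<v))

    lo-nonneg : ∀ v → 0# ≤ lo v
    lo-nonneg v = indicator-nonneg (below v)

    hi-nonneg : ∀ v → 0# ≤ hi v
    hi-nonneg v = indicator-nonneg (not (below v))

    -- The neighbours of the cut: `last` is directly below it, `first` directly above it.
    last first : Fin (suc k)
    last  = inject₁ m
    first = suc m

    last≤m : toℕ last ℕ.≤ toℕ m
    last≤m = ℕ.≤-reflexive (toℕ-inject₁ m)

    m<first : toℕ m ℕ.< toℕ first
    m<first = ℕ.≤-refl

    P R : Carrier
    P = sum lo
    R = sum hi

    P-nonneg : 0# ≤ P
    P-nonneg = sum-nonneg lo lo-nonneg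

    R-nonneg : 0# ≤ R
    R-nonneg = sum-nonneg hi hi-nonneg

    P≉0 : ¬ (P ≈ 0#)
    P≉0 P≈0 = 1≉0 (trans (sym (lo≈1 last≤m)) (sum≈0⇒≈0 lo lo-nonneg P≈0 last))

    R≉0 : ¬ (R ≈ 0#)
    R≉0 R≈0 = 1≉0 (trans (sym (hi≈1 m<first)) (sum≈0⇒≈0 hi hi-nonneg R≈0 first))

    -- Up to scaling, the doubly stochastic block matrix of the barycentre of the facet where the
    -- coordinates below m are smallest, pushed across the facet by 1/A.
    D : Carrier → Matrix (suc k)
    D A a v = lo a * (R * (A * lo v + (δ last v - δ first v))) +
              hi a * (P * (A * hi v - (δ last v - δ first v)))

    -- Applied to f = 1 for the row sums, to rows of the averaged section for nonnegativity, and to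
    -- `value` for the facet violation.
    D-sum : ∀ A a f → sum (λ v → D A a v * f v) ≈
      lo a * (R * (A * sum (λ v → lo v * f v) + (f last - f first))) +
      hi a * (P * (A * sum (λ v → hi v * f v) - (f last - f first)))
    D-sum A a f = begin
      sum (λ v → D A a v * f v)
        ≈⟨ sum-cong-≋ (λ v → solve 10 (λ la ha R P A lv hv δl δf f →
             (la :* (R :* (A :* lv :+ (δl :- δf))) :+ ha :* (P :* (A :* hv :- (δl :- δf)))) :* f :=
             ((la :* R :* A) :* (lv :* f) :+ (ha :* P :* A) :* (hv :* f)) :+
             ((la :* R :- ha :* P) :* (δl :* f) :+ (ha :* P :- la :* R) :* (δf :* f)))
             refl (lo a) (hi a) R P A (lo v) (hi v) (δ last v) (δ first v) (f v)) ⟩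
      sum (λ v → ((lo a * R * A) * (lo v * f v) + (hi a * P * A) * (hi v * f v)) +
                 ((lo a * R - hi a * P) * (δ last v * f v) + (hi a * P - lo a * R) * (δ first v * f v)))
        ≈⟨ sum-combination (lo a * R * A) (hi a * P * A) (lo a * R - hi a * P) (hi a * P - lo a * R)
             (λ v → lo v * f v) (λ v → hi v * f v) (λ v → δ last v * f v) (λ v → δ first v * f v) ⟩
      ((lo a * R * A) * L + (hi a * P * A) * H) +
      ((lo a * R - hi a * P) * sum (λ v → δ last v * f v) + (hi a * P - lo a * R) * sum (λ v → δ first v * f v))
        ≈⟨ +-congˡ (+-cong (*-congˡ (sum-δ last f)) (*-congˡ (sum-δ first f))) ⟩
      ((lo a * R * A) * L + (hi a * P * A) * H) +
      ((lo a * R - hi a * P) * f last + (hi a * P - lo a * R) * f first)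
        ≈⟨ solve 9 (λ la ha R P A L H fl ff →
             ((la :* R :* A) :* L :+ (ha :* P :* A) :* H) :+ ((la :* R :- ha :* P) :* fl :+ (ha :* P :- la :* R) :* ff) :=
             la :* (R :* (A :* L :+ (fl :- ff))) :+ ha :* (P :* (A :* H :- (fl :- ff))))
             refl (lo a) (hi a) R P A L H (f last) (f first) ⟩
      lo a * (R * (A * L + (f last - f first))) + hi a * (P * (A * H - (f last - f first)))
        ∎
      where
      L = sum λ v → lo v * f v
      H = sum λ v → hi v * f v

    D-rows : ∀ A a → sum (D A a) ≈ A * P * R
    D-rows A a = begin
      sum (D A a)
        ≈⟨ sum-cong-≋ (λ v → *-identityʳ (D A a v)) ⟨
      sum (λ v → D A a v * 1#)
        ≈⟨ D-sum A a (λ _ → 1#) ⟩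
      lo a * (R * (A * sum (λ v → lo v * 1#) + (1# - 1#))) + hi a * (P * (A * sum (λ v → hi v * 1#) - (1# - 1#)))
        ≈⟨ +-cong (*-congˡ (*-congˡ (+-congʳ (*-congˡ (sum-cong-≋ λ v → *-identityʳ (lo v))))))
                  (*-congˡ (*-congˡ (+-congʳ (*-congˡ (sum-cong-≋ λ v → *-identityʳ (hi v)))))) ⟩
      lo a * (R * (A * P + (1# - 1#))) + hi a * (P * (A * R - (1# - 1#)))
        ≈⟨ solve 5 (λ la ha R P A → la :* (R :* (A :* P :+ (con (1 , 0) :- con (1 , 0)))) :+
             ha :* (P :* (A :* R :- (con (1 , 0) :- con (1 , 0)))) := (la :+ ha) :* (A :* P :* R)) refl (lo a) (hi a) R P A ⟩
      (lo a + hi a) * (A * P * R)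
        ≈⟨ *-congʳ (indicator-+-not (below a)) ⟩
      1# * (A * P * R)
        ≈⟨ *-identityˡ _ ⟩
      A * P * R
        ∎

    D-columns : ∀ A v → sum (λ a → D A a v) ≈ A * P * R
    D-columns A v = begin
      sum (λ a → lo a * x + hi a * y)
        ≈⟨ sum-cong-≋ (λ a → +-cong (*-comm (lo a) x) (*-comm (hi a) y)) ⟩
      sum (λ a → x * lo a + y * hi a)
        ≈⟨ sum-linear₂ x y lo hi ⟩
      x * P + y * R
        ≈⟨ solve 7 (λ R P A lv hv δl δf → R :* (A :* lv :+ (δl :- δf)) :* P :+ P :* (A :* hv :- (δl :- δf)) :* R :=
             (lv :+ hv) :* (A :* P :* R)) refl R P A (lo v) (hi v) (δ last v) (δ first v) ⟩
      (lo v + hi v) * (A * P * R)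
        ≈⟨ *-congʳ (indicator-+-not (below v)) ⟩
      1# * (A * P * R)
        ≈⟨ *-identityˡ _ ⟩
      A * P * R
        ∎
      where
      x = R * (A * lo v + (δ last v - δ first v))
      y = P * (A * hi v - (δ last v - δ first v))

    -- In `D-sum` the rows below the cut contain - φ first and those above it - φ last. A large `A`
    -- outweighs such a term unless the sum multiplied by `A` vanishes; then the term has to vanish
    -- too.
    Good : Vector Carrier (suc k) → Set
    Good φ = (sum (λ v → lo v * φ v) ≈ 0# → φ first ≈ 0#) × (sum (λ v → hi v * φ v) ≈ 0# → φ last ≈ 0#)

    -- The first nonzero entry is at `first`, respectively the last nonzero entry is at `last`.
    BadLo BadHi Bad : Vector Carrier (suc k) → Set
    BadLo φ = (∀ v → toℕ v ℕ.≤ toℕ m → φ v ≈ 0#) × ¬ (φ first ≈ 0#)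
    BadHi φ = (∀ v → toℕ m ℕ.< toℕ v → φ v ≈ 0#) × ¬ (φ last ≈ 0#)
    Bad φ = BadLo φ ⊎ BadHi φ

    D-sum-nonneg : ∀ {φ} → (∀ v → 0# ≤ φ v) → Good φ →
      ∃[ A₀ ] 0# ≤ A₀ × (∀ A → 0# ≤ A - A₀ → ∀ a → 0# ≤ sum (λ v → D A a v * φ v))
    D-sum-nonneg {φ} 0≤φ (good-lo , good-hi)
      with dominating (sum-nonneg _ λ v → *-nonneg (lo-nonneg v) (0≤φ v)) (0≤φ first) good-lo
         | dominating (sum-nonneg _ λ v → *-nonneg (hi-nonneg v) (0≤φ v)) (0≤φ last) good-hi
    ... | A₁ , 0≤A₁ , dominates₁ | A₂ , 0≤A₂ , dominates₂ =
      A₁ + A₂ , +-nonneg 0≤A₁ 0≤A₂ , λ A 0≤A-A₀ a → ≤-respʳ-≈ (sym (trans (D-sum A a φ)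
        (solve 9 (λ la ha R P A L H fl ff →
           la :* (R :* (A :* L :+ (fl :- ff))) :+ ha :* (P :* (A :* H :- (fl :- ff))) :=
           la :* (R :* ((A :* L :- ff) :+ fl)) :+ ha :* (P :* ((A :* H :- fl) :+ ff)))
           refl (lo a) (hi a) R P A (sum λ v → lo v * φ v) (sum λ v → hi v * φ v) (φ last) (φ first))))
        (+-nonneg
          (*-nonneg (lo-nonneg a) (*-nonneg R-nonneg (+-nonneg
            (dominates₁ A (≤-respʳ-≈ (solve 3 (λ A x y → A :- (x :+ y) :+ y := A :- x) refl A A₁ A₂) (+-nonneg 0≤A-A₀ 0≤A₂)))
            (0≤φ last))))
          (*-nonneg (hi-nonneg a) (*-nonneg P-nonneg (+-nonneg
            (dominates₂ A (≤-respʳ-≈ (solve 3 (λ A x y → A :- (x :+ y) :+ x := A :- y) refl A A₁ A₂) (+-nonneg 0≤A-A₀ 0≤A₁)))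
            (0≤φ first)))))

    -- A vanishing sum of nonnegative terms has only zero terms, so a failure of `Good` locates the
    -- extreme nonzero entry.
    good∨bad : ∀ {φ} → (∀ v → 0# ≤ φ v) → Good φ ⊎ Bad φ
    good∨bad {φ} 0≤φ with zeroImplies? (sum λ v → lo v * φ v) (φ first) | zeroImplies? (sum λ v → hi v * φ v) (φ last)
    ... | inj₁ good-lo     | inj₁ good-hi     = inj₁ (good-lo , good-hi)
    ... | inj₂ (L≈0 , f≉0) | _                = inj₂ (inj₁ ((λ v v≤m →
      trans (trans (sym (*-identityˡ (φ v))) (*-congʳ (sym (lo≈1 v≤m))))
        (sum≈0⇒≈0 _ (λ u → *-nonneg (lo-nonneg u) (0≤φ u)) L≈0 v)) , f≉0))
    ... | _                | inj₂ (H≈0 , l≉0) = inj₂ (inj₂ ((λ v m<v →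
      trans (trans (sym (*-identityˡ (φ v))) (*-congʳ (sym (hi≈1 m<v))))
        (sum≈0⇒≈0 _ (λ u → *-nonneg (hi-nonneg u) (0≤φ u)) H≈0 v)) , l≉0))

    bad-resp : ∀ {φ ψ} → (∀ v → φ v ≈ ψ v) → Bad φ → Bad ψ
    bad-resp φ≈ψ (inj₁ (vanish , f≉0)) =
      inj₁ ((λ v v≤m → trans (sym (φ≈ψ v)) (vanish v v≤m)) , λ f≈0 → f≉0 (trans (φ≈ψ first) f≈0))
    bad-resp φ≈ψ (inj₂ (vanish , l≉0)) =
      inj₂ ((λ v m<v → trans (sym (φ≈ψ v)) (vanish v m<v)) , λ l≈0 → l≉0 (trans (φ≈ψ last) l≈0))

    bad⇒zero : ∀ {φ} → Bad φ → ∃[ v ] ∃[ w ] φ v ≈ 0# × ¬ (φ w ≈ 0#)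
    bad⇒zero (inj₁ (vanish , f≉0)) = last , first , vanish last last≤m , f≉0
    bad⇒zero (inj₂ (vanish , l≉0)) = first , last , vanish first m<first , l≉0

all∨some : ∀ {n} {P Q : Fin n → Set} → (∀ i → P i ⊎ Q i) → (∀ i → P i) ⊎ ∃ Q
all∨some {zero}  _ = inj₁ λ ()
all∨some {suc n} P∨Q with P∨Q zero | all∨some (P∨Q ∘ suc)
... | inj₂ q | _            = inj₂ (zero , q)
... | inj₁ _ | inj₂ (i , q) = inj₂ (suc i , q)
... | inj₁ p | inj₁ ps      = inj₁ λ { zero → p ; (suc i) → ps i }

transpose-matchˡ : ∀ {n} (i j : Fin n) → Perm.transpose i j ⟨$⟩ʳ i ≡ j
transpose-matchˡ i j rewrite dec-true (i ≟ i) ≡.refl = ≡.refl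

transpose-mismatch : ∀ {n} {i j k : Fin n} → k ≢ i → k ≢ j → Perm.transpose i j ⟨$⟩ʳ k ≡ k
transpose-mismatch {i = i} {j} {k} k≢i k≢j rewrite dec-false (k ≟ i) k≢i | dec-false (k ≟ j) k≢j = ≡.refl

-- Counting obstructions to find an unobstructed threshold.

module GoodThreshold (ℝ : Reals) where
  open Reals ℝ hiding (zero)
  open OrderedField ℝ
  open Averages ℝ
  open Thresholds ℝ
  open Threshold
  open Relation.Binary.Reasoning.Setoid setoid

  vectorDecSetoid : ℕ → DecSetoid 0ℓ 0ℓ
  vectorDecSetoid n = Pointwise.decSetoid (record
    { isDecEquivalence = record { isEquivalence = isEquivalence ; _≟_ = _≈?_ } }) n

  module _ {d k} (g : Fin d → Matrix (4 ℕ.+ k))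
    (g-nonneg : ∀ j a v → 0# ≤ g j a v)
    (g-columns : ∀ j → ∃[ t ] ∀ v → sum (λ a → g j a v) ≈ t)
    (g-symmetric : ∀ π → Σ (Fin d → Fin d) λ σ → ∀ j a v → g (σ j) a v ≈ g j (π ⟨$⟩ʳ a) v)
    (d-small : d ℕ.* 2 ℕ.< (4 ℕ.+ k) ℕ.* (3 ℕ.+ k))
    where
    private
      n = 4 ℕ.+ k

    open Arrangement (vectorDecSetoid n) using (constantOff∨matching; matching⇒arrangements)

    act : Permutation′ n → Fin d → Fin d
    act π = proj₁ (g-symmetric π)

    g-act : ∀ π j a v → g (act π j) a v ≈ g j (π ⟨$⟩ʳ a) v
    g-act π = proj₂ (g-symmetric π)

    -- Otherwise the rows contain a matching, and the resulting n(n-1)/2 row arrangements are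
    -- realised by pairwise different indices, more than `d` allows.
    exceptional : ∀ j → ∃ (EqualRowsOff (g j))
    exceptional j with constantOff∨matching k (g j)
    ... | inj₁ off = off
    ... | inj₂ M with matching⇒arrangements k (g j) M
    ...   | π , π-inj = contradiction (ℕ.*-monoˡ-≤ 2 (injective⇒≤ act-injective))
        (ℕ.<⇒≱ (≡.subst (d ℕ.* 2 ℕ.<_) (≡.sym (tri*2 (3 ℕ.+ k))) d-small))
      where
      act-injective : ∀ {i i′} → act (π i) j ≡ act (π i′) j → i ≡ i′
      act-injective {i} {i′} eq = π-inj i i′ λ a v → begin
        g j (π i ⟨$⟩ʳ a) v    ≈⟨ g-act (π i) j a v ⟨
        g (act (π i) j) a v   ≡⟨ cong (λ l → g l a v) eq ⟩
        g (act (π i′) j) a v  ≈⟨ g-act (π i′) j a v ⟩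
        g j (π i′ ⟨$⟩ʳ a) v   ∎

    -- With two exceptional rows, comparison with a third row makes all rows equal. Equal column
    -- sums then make row `a` constant, but a bad row has both a zero and a nonzero entry.
    exceptional-unique : ∀ {m : Fin (3 ℕ.+ k)} {j a b} → EqualRowsOff (g j) a → EqualRowsOff (g j) b → Bad m (g j a) → a ≡ b
    exceptional-unique {m} {j} {a} {b} off-a off-b bad with a ≟ b
    ... | yes a≡b = a≡b
    ... | no  a≢b with fresh {2} (ℕ.s≤s (ℕ.s≤s (ℕ.s≤s ℕ.z≤n))) (a ∷ b ∷ []) | bad⇒zero m bad
    ...   | c , c≢ | v , w , v≈0 , w≉0 = contradiction (*≈0⇒≈0 (suc×#≉0 (3 ℕ.+ k)) (begin
      n ×# 1# * g j a w        ≈⟨ scaled w ⟩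
      t                 ≈⟨ scaled v ⟨
      n ×# 1# * g j a v        ≈⟨ *-congˡ v≈0 ⟩
      n ×# 1# * 0#             ≈⟨ zeroʳ _ ⟩
      0#                       ∎)) w≉0
      where
      t = proj₁ (g-columns j)

      equalRows : ∀ e u → g j e u ≈ g j a u
      equalRows e u with e ≟ b
      ... | no  e≢b = off-b e a e≢b a≢b u
      ... | yes ≡.refl = trans (off-a e c (a≢b ∘ ≡.sym) (c≢ 0F) u) (off-b c a (c≢ 1F) a≢b u)

      scaled : ∀ u → n ×# 1# * g j a u ≈ t
      scaled u = begin
        n ×# 1# * g j a u           ≈⟨ sum-const n (g j a u) ⟨
        sum {n} (λ _ → g j a u)     ≈⟨ sum-cong-≋ {n} (λ e → equalRows e u) ⟨
        sum (λ e → g j e u)         ≈⟨ proj₂ (g-columns j) u ⟩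
        t                    ∎

    side : ∀ {m : Fin (3 ℕ.+ k)} {φ} → Bad m φ → Fin 2
    side (inj₁ _) = 0F
    side (inj₂ _) = 1F

    -- The threshold of a bad vector is read off from its first (or last) nonzero entry.
    side-injective : ∀ {l m : Fin (3 ℕ.+ k)} {φ} (p : Bad l φ) (q : Bad m φ) → side p ≡ side q → l ≡ m
    side-injective {l} {m} (inj₁ (vanish , f≉0)) (inj₁ (vanish′ , f′≉0)) _ with ℕ.<-cmp (toℕ l) (toℕ m)
    ... | tri< l<m _ _ = contradiction (vanish′ (suc l) l<m) f≉0
    ... | tri≈ _ l≡m _ = toℕ-injective l≡m
    ... | tri> _ _ m<l = contradiction (vanish (suc m) m<l) f′≉0
    side-injective {l} {m} (inj₂ (vanish , l≉0)) (inj₂ (vanish′ , l′≉0)) _ with ℕ.<-cmp (toℕ l) (toℕ m)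
    ... | tri< l<m _ _ = contradiction (vanish (inject₁ m) (≡.subst (toℕ l ℕ.<_) (≡.sym (toℕ-inject₁ m)) l<m)) l′≉0
    ... | tri≈ _ l≡m _ = toℕ-injective l≡m
    ... | tri> _ _ m<l = contradiction (vanish′ (inject₁ l) (≡.subst (toℕ m ℕ.<_) (≡.sym (toℕ-inject₁ l)) m<l)) l≉0

    BadAt : Fin (3 ℕ.+ k) → Fin n → Fin d → Set
    BadAt m a j = EqualRowsOff (g j) a × Bad m (g j a)

    -- The transposition of `a` and `b` carries an obstruction in row `b` to one in row `a`, so an
    -- obstructed threshold has obstructions in all n rows.
    move-bad : ∀ {m b j} → BadAt m b j → ∀ a → ∃ (BadAt m a)
    move-bad {m} {b} {j} (off , bad) a =
      act π j ,
      (λ c e c≢a e≢a v → trans (g-act π j c v) (trans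
        (off _ _ (moved c≢a) (moved e≢a) v) (sym (g-act π j e v)))) ,
      bad-resp m (λ v → trans (reflexive (cong (λ e → g j e v) (≡.sym πa≡b))) (sym (g-act π j a v))) bad
      where
      π = Perm.transpose a b

      πa≡b : π ⟨$⟩ʳ a ≡ b
      πa≡b = transpose-matchˡ a b

      moved : ∀ {c} → c ≢ a → π ⟨$⟩ʳ c ≢ b
      moved c≢a πc≡b = c≢a (≡.trans (≡.sym (Perm.inverseˡ π))
        (≡.trans (cong (π ⟨$⟩ˡ_) (≡.trans πc≡b (≡.sym πa≡b))) (Perm.inverseˡ π)))

    sameWitness : ∀ {l m a b i j} (p : BadAt l a i) (q : BadAt m b j) → i ≡ j →
                  side (proj₂ p) ≡ side (proj₂ q) → (l , a) ≡ (m , b)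
    sameWitness {a = a} (off , p) (off′ , q) ≡.refl eq with exceptional-unique off off′ p
    ... | ≡.refl = cong (_, a) (side-injective p q eq)

    -- Sending a threshold and a row to an obstructing index and its side would be injective, by
    -- `sameWitness`, from n(n-1) pairs into 2d.
    not-all-bad : ¬ (∀ m → ∃[ j ] ∃[ a ] BadAt m a j)
    not-all-bad bad = ℕ.<⇒≱ (≡.subst (d ℕ.* 2 ℕ.<_) (ℕ.*-comm n (3 ℕ.+ k)) d-small) (injective⇒≤ code-injective)
      where
      witness : ∀ m a → ∃ (BadAt m a)
      witness m = move-bad (proj₂ (proj₂ (bad m)))

      code : Fin (3 ℕ.+ k) × Fin n → Fin (d ℕ.* 2)
      code (m , a) = combine (proj₁ (witness m a)) (side (proj₂ (proj₂ (witness m a))))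

      code-injective′ : ∀ x y → code x ≡ code y → x ≡ y
      code-injective′ (l , a) (m , b) eq = let j≡ , side≡ = combine-injective _ _ _ _ eq in
        sameWitness (proj₂ (witness l a)) (proj₂ (witness m b)) j≡ side≡

      code-injective : ∀ {i i′} → code (remQuot n i) ≡ code (remQuot n i′) → i ≡ i′
      code-injective {i} {i′} eq = ≡.trans (≡.sym (combine-remQuot {3 ℕ.+ k} n i)) (≡.trans
        (cong (λ (m , a) → combine m a) (code-injective′ _ _ eq)) (combine-remQuot {3 ℕ.+ k} n i′))

    GoodAt : Fin (3 ℕ.+ k) → Fin d → Set
    GoodAt m j = ∃[ a ] EqualRowsOff (g j) a × Good m (g j a)

    goodAt∨badAt : ∀ m j → GoodAt m j ⊎ ∃[ a ] BadAt m a j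
    goodAt∨badAt m j = let a , off = exceptional j in
      [ (λ good → inj₁ (a , off , good)) , (λ bad → inj₂ (a , off , bad)) ]′ (good∨bad m (g-nonneg j a))

    goodThreshold : ∃[ m ] ∀ j → GoodAt m j
    goodThreshold = [ (λ bad → contradiction bad not-all-bad) , (λ good → good) ]′
      (all∨some λ m → swap (all∨some (goodAt∨badAt m)))

-- Weighted sums of vertex coordinates.

module Coordinates (ℝ : Reals) where
  open Reals ℝ hiding (zero)
  open OrderedField ℝ
  open Averages ℝ
  open Relation.Binary.Reasoning.Setoid setoid

  order : ℕ → Carrier
  order n = ∑ₚ {n} λ _ → 1#

  order-nonneg : ∀ n → 0# ≤ order n
  order-nonneg n = sum-nonneg {n !} _ λ _ → 0≤1

  order≉0 : ∀ n → ¬ (order n ≈ 0#)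
  order≉0 n N≈0 = 1≉0 (sum≈0⇒≈0 {n !} _ (λ _ → 0≤1) N≈0 (index n Perm.id))

  module _ {n : ℕ} (f : Vector Carrier n) where

    -- Coordinate `b` of the vertex after relabelling values by `f`: `value` gives the vertex
    -- itself, the constant 1 gives the total weight.
    entry : Fin n → Permutation′ n → Carrier
    entry b ζ = f (ζ ⟨$⟩ˡ b)

    entry-respectful : ∀ b → Respectful (entry b)
    entry-respectful b {π} {ρ} π≈ρ = reflexive (cong f (⟨$⟩ˡ-cong {π = π} {ρ} π≈ρ b))

    -- Transposing two positions other than `b` exchanges their rows and leaves coordinate `b`
    -- unchanged.
    entry-equalRowsOff : ∀ b → EqualRowsOff (T (entry b)) b
    entry-equalRowsOff b c e c≢b e≢b v = begin
      T (entry b) c v                            ≈⟨ T-cong (λ ζ → reflexive (cong (λ i → f (ζ ⟨$⟩ˡ i)) fixed)) c v ⟨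
      T (λ ζ → entry b (ζ Perm.∘ₚ π)) c v        ≈⟨ T-translate {h = entry b} (λ {π} {ρ} → entry-respectful b {π} {ρ}) π c v ⟨
      T (entry b) (π ⟨$⟩ʳ c) v                   ≡⟨ cong (λ i → T (entry b) i v) (transpose-matchˡ c e) ⟩
      T (entry b) e v                            ∎
      where
      π = Perm.transpose c e

      fixed : π ⟨$⟩ˡ b ≡ b
      fixed = transpose-mismatch (e≢b ∘ ≡.sym) (c≢b ∘ ≡.sym)

  T-1 : ∀ {n} a v → n ×# 1# * T {n} (λ _ → 1#) a v ≈ order n
  T-1 {n} a v = begin
    n ×# 1# * T (λ _ → 1#) a v       ≈⟨ sum-const n _ ⟨
    sum {n} (λ _ → T (λ _ → 1#) a v) ≈⟨ sum-cong-≋ {n} equal ⟩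
    sum (λ b → T (λ _ → 1#) b v)     ≈⟨ T-columns (λ _ → 1#) v ⟩
    order n                          ∎
    where
    equal : ∀ b → T (λ _ → 1#) a v ≈ T (λ _ → 1#) b v
    equal b = trans (sym (T-translate (λ _ → refl) (Perm.transpose a b) a v))
      (reflexive (cong (λ i → T (λ _ → 1#) i v) (transpose-matchˡ a b)))

  T-entry : ∀ {n} f b v → T (entry f b) b v ≈ f v * T {n} (λ _ → 1#) b v
  T-entry {n} f b v = trans (sum-cong-≋ {n !} λ i → pointwise (enumerate n i))
    (sym (*-distribˡ-sum (f v) λ i → δ (enumerate n i ⟨$⟩ʳ v) b * 1#))
    where
    pointwise : ∀ ζ → δ (ζ ⟨$⟩ʳ v) b * f (ζ ⟨$⟩ˡ b) ≈ f v * (δ (ζ ⟨$⟩ʳ v) b * 1#)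
    pointwise ζ with ζ ⟨$⟩ʳ v ≟ b
    ... | no  _    = trans (zeroˡ _) (sym (trans (*-congˡ (zeroˡ 1#)) (zeroʳ (f v))))
    ... | yes ≡.refl = trans (*-congˡ (reflexive (cong f (Perm.inverseˡ ζ))))
      (solve 1 (λ x → con (1 , 0) :* x := x :* (con (1 , 0) :* con (1 , 0))) refl (f v))

  -- The exceptional row is `b` itself. Its entry at `v` is `f v` times an entry of the matrix of
  -- the constant 1, and n times that entry is `order n`.
  weightedSum-entry : ∀ {k} (D : Matrix (2 ℕ.+ k)) ρ →
    (∀ a → sum (D a) ≈ ρ) → (∀ v → sum (λ a → D a v) ≈ ρ) → ∀ f b →
    ∑ₚ (λ ζ → weight D ρ ζ * entry f b ζ) ≈ order (2 ℕ.+ k) * sum (λ v → D b v * f v)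
  weightedSum-entry {k} D ρ D-rows D-columns f b = begin
    ∑ₚ (λ ζ → weight D ρ ζ * entry f b ζ)
      ≈⟨ weightedSum D ρ D-rows D-columns (entry f b) (entry-equalRowsOff f b) ⟩
    n ×# 1# * sum (λ v → D b v * T (entry f b) b v)
      ≈⟨ *-distribˡ-sum (n ×# 1#) (λ v → D b v * T (entry f b) b v) ⟩
    sum (λ v → n ×# 1# * (D b v * T (entry f b) b v))
      ≈⟨ sum-cong-≋ {n} (λ v → trans (*-congˡ (*-congˡ (T-entry f b v))) (trans
           (solve 4 (λ ν x y t → ν :* (x :* (y :* t)) := (ν :* t) :* (x :* y)) refl
             (n ×# 1#) (D b v) (f v) (T {n} (λ _ → 1#) b v))
           (*-congʳ (T-1 b v)))) ⟩
    sum (λ v → order n * (D b v * f v))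
      ≈⟨ *-distribˡ-sum (order n) (λ v → D b v * f v) ⟨
    order n * sum (λ v → D b v * f v)
      ∎
    where n = 2 ℕ.+ k

-- Affine combinations and facet inequalities of the permutahedron.

module Polyhedra (ℝ : Reals) where
  open Reals ℝ hiding (zero)
  open Extensions ℝ hiding (X)
  open OrderedField ℝ
  open Averages ℝ
  open Thresholds ℝ
  open Relation.Binary.Reasoning.Setoid setoid

  module _ {d} {L : Pred (Vector Carrier d) 0ℓ} (affine : IsAffineSubspace L) where
    open IsAffineSubspace affine

    module _ {y₀ : Vector Carrier d} (Ly₀ : L y₀) where
      private
        Direction : Pred (Vector Carrier d) 0ℓ
        Direction u = L λ v → y₀ v + u v

      direction-scale : ∀ c {u} → Direction u → Direction λ v → c * u v
      direction-scale c {u} Lu = respects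
        (λ v → solve 3 (λ c y u → c :* (y :+ u) :+ (con (1 , 0) :- c) :* y := y :+ c :* u) refl c (y₀ v) (u v))
        (line c Lu Ly₀)

      -- The point y₀ + u + w is the midpoint of y₀ + 2u and y₀ + 2w.
      direction-+ : ∀ {u w} → Direction u → Direction w → Direction λ v → u v + w v
      direction-+ {u} {w} Lu Lw with inverse (1# + 1#) (λ 2≈0 → 1≉0 (+≈0⇒≈0 0≤1 0≤1 2≈0))
      ... | c , 2c≈1 = respects
        (λ v → begin
          c * (y₀ v + (1# + 1#) * u v) + (1# - c) * (y₀ v + (1# + 1#) * w v)
            ≈⟨ solve 4 (λ c y u w → let two = con (1 , 0) :+ con (1 , 0) in
                 c :* (y :+ two :* u) :+ (con (1 , 0) :- c) :* (y :+ two :* w) :=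
                 y :+ ((two :* c) :* u :+ (two :- two :* c) :* w)) refl c (y₀ v) (u v) (w v) ⟩
          y₀ v + (((1# + 1#) * c) * u v + ((1# + 1#) - (1# + 1#) * c) * w v)
            ≈⟨ +-congˡ (+-cong (*-congʳ 2c≈1) (*-congʳ (+-congˡ (-‿cong 2c≈1)))) ⟩
          y₀ v + (1# * u v + ((1# + 1#) - 1#) * w v)
            ≈⟨ solve 3 (λ y u w → y :+ (con (1 , 0) :* u :+ ((con (1 , 0) :+ con (1 , 0)) :- con (1 , 0)) :* w) :=
                 y :+ (u :+ w)) refl (y₀ v) (u v) (w v) ⟩
          y₀ v + (u v + w v)
            ∎)
        (line c (direction-scale (1# + 1#) Lu) (direction-scale (1# + 1#) Lw))

      direction-sum : ∀ {N} (w : Vector Carrier N) (u : Fin N → Vector Carrier d) → (∀ i → Direction (u i)) →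
                      Direction λ v → sum λ i → w i * u i v
      direction-sum {zero}  w u Lu = respects (λ v → sym (+-identityʳ (y₀ v))) Ly₀
      direction-sum {suc N} w u Lu =
        direction-+ (direction-scale (w zero) (Lu zero)) (direction-sum (w ∘ suc) (u ∘ suc) (Lu ∘ suc))

      -- Sum the directions y i - y₀; since the weights add up to 1, the base point cancels.
      -- Negative weights are allowed.
      affineCombination : ∀ {N} (w : Vector Carrier N) (y : Fin N → Vector Carrier d) → (∀ i → L (y i)) →
                          sum w ≈ 1# → L λ v → sum λ i → w i * y i v
      affineCombination {N} w y Ly sum-w≈1 = respects
        (λ v → begin
          y₀ v + sum (λ i → w i * (y i v - y₀ v))
            ≈⟨ +-congˡ (sum-cong-≋ λ i → solve 3 (λ w y z → w :* (y :- z) := con (1 , 0) :* (w :* y) :+ (:- z) :* w) refl (w i) (y i v) (y₀ v)) ⟩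
          y₀ v + sum (λ i → 1# * (w i * y i v) + (- y₀ v) * w i)
            ≈⟨ +-congˡ (sum-linear₂ 1# (- y₀ v) (λ i → w i * y i v) w) ⟩
          y₀ v + (1# * sum (λ i → w i * y i v) + (- y₀ v) * sum w)
            ≈⟨ +-congˡ (+-congˡ (*-congˡ sum-w≈1)) ⟩
          y₀ v + (1# * sum (λ i → w i * y i v) + (- y₀ v) * 1#)
            ≈⟨ solve 2 (λ y s → y :+ (con (1 , 0) :* s :+ (:- y) :* con (1 , 0)) := s) refl (y₀ v) _ ⟩
          sum (λ i → w i * y i v)
            ∎)
        (direction-sum w (λ i v → y i v - y₀ v) λ i → respects
          (λ v → solve 2 (λ y z → y := z :+ (y :- z)) refl (y i v) (y₀ v)) (Ly i))

  linear-sum : ∀ {d n} {p : Vector Carrier d → Vector Carrier n} → IsLinear p →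
               ∀ {N} (w : Vector Carrier N) (y : Fin N → Vector Carrier d) b →
               p (λ v → sum λ i → w i * y i v) b ≈ sum λ i → w i * p (y i) b
  linear-sum linear {zero} w y b = 0ᴹ-homo b
    where open LeftModuleMorphisms.IsLeftModuleHomomorphism linear
  linear-sum {p = p} linear {suc N} w y b = trans
    (+ᴹ-homo (λ v → w zero * y zero v) (λ v → sum λ i → w (suc i) * y (suc i) v) b)
    (+-cong (*ₗ-homo (w zero) (y zero) b) (linear-sum linear (w ∘ suc) (y ∘ suc) b))
    where open LeftModuleMorphisms.IsLeftModuleHomomorphism linear

  value : ∀ {n} → Fin n → Carrier
  value v = suc (toℕ v) ×# 1#

  module Facet {k} (m : Fin k) where
    open Threshold m

    -- The facet inequality of the cut is `0# ≤ slack x`: the coordinates at positions below it sum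
    -- to at least 1 + 2 + ... + (toℕ m + 1).
    slack : Vector Carrier (suc k) → Carrier
    slack x = sum (λ b → lo b * x b) - sum (λ v → lo v * value v)

    slack-cong : ∀ {x y} → (∀ b → x b ≈ y b) → slack x ≈ slack y
    slack-cong x≈y = +-congʳ (sum-cong-≋ λ b → *-congˡ {lo b} (x≈y b))

    -- Exchange argument: the first factor is at most 0 for `v` below the cut and at least 0 above
    -- it, and so is the second.
    slack-term : ∀ b v → 0# ≤ (lo b - lo v) * (value v - suc (toℕ m) ×# 1#)
    slack-term b v with toℕ v ℕ.≤? toℕ m
    ... | yes v≤m = ≤-respʳ-≈ (trans
      (solve 4 (λ l h x c → h :* (c :- x) := (l :- (l :+ h)) :* (x :- c)) refl (lo b) (hi b) (value v) (suc (toℕ m) ×# 1#))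
      (*-congʳ (+-congˡ (-‿cong (trans (indicator-+-not (below b)) (sym (lo≈1 v≤m)))))))
      (*-nonneg (hi-nonneg b) (×#-mono (ℕ.s≤s v≤m)))
    ... | no  v≰m = ≤-respʳ-≈
      (*-congʳ (trans (solve 1 (λ l → l := l :- con (0 , 0)) refl (lo b))
        (+-congˡ (-‿cong (reflexive (cong indicator (≡.sym (below-false m<v))))))))
      (*-nonneg (lo-nonneg b) (×#-mono (ℕ.s≤s (ℕ.<⇒≤ m<v))))
      where m<v = ℕ.≰⇒> v≰m

    -- Sum `slack-term` over the positions `b` with `v` the value carried there. The constant `c`
    -- cancels because permuting `lo` keeps its sum.
    slack-vertex : ∀ ζ → 0# ≤ slack (vertex ζ)
    slack-vertex ζ = ≤-respʳ-≈ (begin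
      sum (λ b → (lo b - lo (ζ ⟨$⟩ˡ b)) * (x b - c))
        ≈⟨ sum-cong-≋ (λ b → solve 4 (λ l l′ x c → (l :- l′) :* (x :- c) :=
             (con (1 , 0) :* (l :* x) :+ (:- con (1 , 0)) :* (l′ :* x)) :+ ((:- c) :* l :+ c :* l′)) refl
             (lo b) (lo (ζ ⟨$⟩ˡ b)) (x b) c) ⟩
      sum (λ b → (1# * (lo b * x b) + (- 1#) * (lo (ζ ⟨$⟩ˡ b) * x b)) + ((- c) * lo b + c * lo (ζ ⟨$⟩ˡ b)))
        ≈⟨ sum-combination 1# (- 1#) (- c) c (λ b → lo b * x b) (λ b → lo (ζ ⟨$⟩ˡ b) * x b) lo (λ b → lo (ζ ⟨$⟩ˡ b)) ⟩
      (1# * X + (- 1#) * sum (λ b → lo (ζ ⟨$⟩ˡ b) * x b)) + ((- c) * P + c * sum (λ b → lo (ζ ⟨$⟩ˡ b)))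
        ≈⟨ +-cong (+-congˡ (*-congˡ (sum-permute (λ v → lo v * value v) (Perm.flip ζ))))
                  (+-congˡ (*-congˡ (sum-permute lo (Perm.flip ζ)))) ⟨
      (1# * X + (- 1#) * M) + ((- c) * P + c * P)
        ≈⟨ solve 4 (λ X M c P → (con (1 , 0) :* X :+ (:- con (1 , 0)) :* M) :+ ((:- c) :* P :+ c :* P) := X :- M) refl X M c P ⟩
      X - M
        ∎)
      (sum-nonneg _ λ b → slack-term b (ζ ⟨$⟩ˡ b))
      where
      c = suc (toℕ m) ×# 1#
      x = vertex ζ
      X = sum λ b → lo b * x b
      M = sum λ v → lo v * value v

    slack-permutahedron : ∀ {x} → Permutahedron (suc k) x → 0# ≤ slack x
    slack-permutahedron {x} (N , w , z , z-vertex , 0≤w , sum-w≈1 , x≈) = ≤-respʳ-≈ (begin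
      sum (λ i → w i * slack (z i))
        ≈⟨ sum-cong-≋ (λ i → solve 3 (λ w X M → w :* (X :- M) := con (1 , 0) :* (w :* X) :+ (:- M) :* w) refl
             (w i) (sum λ b → lo b * z i b) M) ⟩
      sum (λ i → 1# * (w i * sum (λ b → lo b * z i b)) + (- M) * w i)
        ≈⟨ sum-linear₂ 1# (- M) (λ i → w i * sum λ b → lo b * z i b) w ⟩
      1# * sum (λ i → w i * sum (λ b → lo b * z i b)) + (- M) * sum w
        ≈⟨ +-cong (*-identityˡ _) (trans (*-congˡ sum-w≈1) (*-identityʳ (- M))) ⟩
      sum (λ i → w i * sum (λ b → lo b * z i b)) - M
        ≈⟨ +-congʳ exchange ⟩
      slack (λ b → sum λ i → w i * z i b)
        ≈⟨ slack-cong x≈ ⟨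
      slack x
        ∎)
      (sum-nonneg _ λ i → *-nonneg (0≤w i)
        (≤-respʳ-≈ (sym (slack-cong (proj₂ (z-vertex i)))) (slack-vertex (proj₁ (z-vertex i)))))
      where
      M = sum λ v → lo v * value v

      exchange : sum (λ i → w i * sum (λ b → lo b * z i b)) ≈ sum (λ b → lo b * sum λ i → w i * z i b)
      exchange = begin
        sum (λ i → w i * sum (λ b → lo b * z i b))
          ≈⟨ sum-cong-≋ (λ i → *-distribˡ-sum (w i) λ b → lo b * z i b) ⟩
        sum (λ i → sum (λ b → w i * (lo b * z i b)))
          ≈⟨ ∑-comm (λ i b → w i * (lo b * z i b)) ⟩
        sum (λ b → sum (λ i → w i * (lo b * z i b)))
          ≈⟨ sum-cong-≋ (λ b → sum-cong-≋ λ i → solve 3 (λ w l z → w :* (l :* z) := l :* (w :* z)) refl (w i) (lo b) (z i b)) ⟩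
        sum (λ b → sum (λ i → lo b * (w i * z i b)))
          ≈⟨ sum-cong-≋ (λ b → *-distribˡ-sum (lo b) λ i → w i * z i b) ⟨
        sum (λ b → lo b * sum (λ i → w i * z i b))
          ∎

-- The point of the extension that projects outside the permutahedron.

module Nonexistence (ℝ : Reals) where
  open Reals ℝ hiding (zero)
  open Extensions ℝ
  open OrderedField ℝ
  open Averages ℝ
  open Thresholds ℝ
  open GoodThreshold ℝ
  open Coordinates ℝ
  open Polyhedra ℝ
  open Relation.Binary.Reasoning.Setoid setoid

  indicator-select : ∀ b κ N x y →
    indicator b * (κ * (N * (indicator b * x + indicator (not b) * y))) ≈ (κ * N * x) * indicator b
  indicator-select true κ N x y =
    solve 4 (λ κ N x y → con (1 , 0) :* (κ :* (N :* (con (1 , 0) :* x :+ con (0 , 0) :* y))) := (κ :* N :* x) :* con (1 , 0))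
      refl κ N x y
  indicator-select false κ N x y =
    solve 4 (λ κ N x y → con (0 , 0) :* (κ :* (N :* (con (0 , 0) :* x :+ con (1 , 0) :* y))) := (κ :* N :* x) :* con (0 , 0))
      refl κ N x y

  module Section {k d} {Q : Pred (Vector Carrier d) 0ℓ} {p : Vector Carrier d → Vector Carrier (2 ℕ.+ k)}
    (extension : IsSubspaceExtension Q p)
    (s : MapFromX (2 ℕ.+ k) d) (weaklySymmetric : IsWeaklySymmetricSection Q p s)
    where
    open Func s using (to) renaming (cong to to-cong)
    open IsSubspaceExtension extension
    open IsWeaklySymmetricSection weaklySymmetric
    open IsSection isSection

    private
      n = 2 ℕ.+ k

    point : Permutation′ n → Setoid.Carrier (X n)
    point ζ = vertex ζ , ζ , λ _ → refl

    h : Fin d → Permutation′ n → Carrier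
    h j ζ = to (point ζ) j

    h-nonneg : ∀ j ζ → 0# ≤ h j ζ
    h-nonneg j ζ = proj₂ (Equivalence.to (Q-intersection _) (into-Q (point ζ))) j

    h-L : ∀ ζ → L λ j → h j ζ
    h-L ζ = proj₁ (Equivalence.to (Q-intersection _) (into-Q (point ζ)))

    h-respectful : ∀ j → Respectful (h j)
    h-respectful j {π} {ρ} π≈ρ = to-cong {point π} {point ρ}
      (λ v → reflexive (cong value (⟨$⟩ˡ-cong {π = π} {ρ} π≈ρ v))) j

    -- The vertex of `ζ ∘ₚ π` is `π` applied to that of `ζ`, so weak symmetry turns translation by
    -- `π` into a renaming of the components of the section.
    T-symmetric : ∀ π → Σ (Fin d → Fin d) λ σ → ∀ j a v → T (h (σ j)) a v ≈ T (h j) (π ⟨$⟩ʳ a) v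
    T-symmetric π = let ϰ , ϰ-symmetric = symmetric π in ϰ ⟨$⟩ˡ_ , λ j a v → sym (trans
      (T-translate {h = h j} (λ {π} {ρ} → h-respectful j {π} {ρ}) π a v)
      (T-cong (λ ζ → trans (to-cong {point (ζ Perm.∘ₚ π)} {π ∙ˣ point ζ} (λ _ → refl) j) (ϰ-symmetric (point ζ) j)) a v))

    module _ (m : Fin (suc k)) (good : ∀ j → ∃[ a ] EqualRowsOff (T (h j)) a × Threshold.Good m (T (h j) a)) where
      open Threshold m using (below; lo; hi; P; R; P-nonneg; R-nonneg; P≉0; R≉0; last; first; D-rows; D-columns; D-sum; D-sum-nonneg)
        renaming (D to D′)
      open Facet m using (slack; slack-permutahedron; slack-cong)

      row : Fin d → Fin n
      row j = proj₁ (good j)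

      scale : ∀ j → ∃[ A₀ ] 0# ≤ A₀ × (∀ A → 0# ≤ A - A₀ → ∀ a → 0# ≤ sum (λ v → D′ A a v * T (h j) (row j) v))
      scale j = D-sum-nonneg (T-nonneg (h-nonneg j) (row j)) (proj₂ (proj₂ (good j)))

      scales : Vector Carrier d
      scales j = proj₁ (scale j)

      scales-nonneg : ∀ j → 0# ≤ scales j
      scales-nonneg j = proj₁ (proj₂ (scale j))

      -- `A` is at least as large as every scale, and the summand 1 keeps it nonzero; `ρ` is the
      -- common line sum of `D`.
      A ρ : Carrier
      A = 1# + sum scales
      ρ = A * P * R

      D : Matrix n
      D = D′ A

      A-large : ∀ j → 0# ≤ A - scales j
      A-large j = ≤-respʳ-≈ (sym (+-assoc 1# (sum scales) (- scales j)))
        (+-nonneg 0≤1 (sum-bounds-term scales scales-nonneg j))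

      A-nonneg : 0# ≤ A
      A-nonneg = +-nonneg 0≤1 (sum-nonneg scales scales-nonneg)

      A≉0 : ¬ (A ≈ 0#)
      A≉0 A≈0 = 1≉0 (+≈0⇒≈0 0≤1 (sum-nonneg scales scales-nonneg) A≈0)

      ρ-nonneg : 0# ≤ ρ
      ρ-nonneg = *-nonneg (*-nonneg A-nonneg P-nonneg) R-nonneg

      N : Carrier
      N = order n

      normaliser : ∃[ κ ] (ρ * N) * κ ≈ 1#
      normaliser = inverse (ρ * N) (*≉0 (*≉0 (*≉0 A≉0 P≉0) R≉0) (order≉0 n))

      κ : Carrier
      κ = proj₁ normaliser

      κ-nonneg : 0# ≤ κ
      κ-nonneg = inverse-nonneg (*-nonneg ρ-nonneg (order-nonneg n)) (proj₂ normaliser)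

      w : Permutation′ n → Carrier
      w = weight D ρ

      ∑w : (Permutation′ n → Carrier) → Carrier
      ∑w f = ∑ₚ λ ζ → (κ * w ζ) * f ζ

      ∑w-scaled : ∀ f → ∑w f ≈ κ * ∑ₚ (λ ζ → w ζ * f ζ)
      ∑w-scaled f = trans (sum-cong-≋ {n !} λ i → *-assoc κ (w (enumerate n i)) (f (enumerate n i)))
        (sym (*-distribˡ-sum κ λ i → w (enumerate n i) * f (enumerate n i)))

      ∑w-entry : ∀ f b → ∑w (entry f b) ≈ κ * (N * sum (λ v → D b v * f v))
      ∑w-entry f b = trans (∑w-scaled (entry f b)) (*-congˡ (weightedSum-entry D ρ (D-rows A) (D-columns A) f b))

      y : Vector Carrier d
      y j = ∑w (h j)

      -- By `weightedSum` only row `row j` is left, and there the choice of `A` applies.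
      y-nonneg : ∀ j → 0# ≤ y j
      y-nonneg j = ≤-respʳ-≈
        (sym (trans (∑w-scaled (h j)) (*-congˡ (weightedSum D ρ (D-rows A) (D-columns A) (h j) (proj₁ (proj₂ (good j)))))))
        (*-nonneg κ-nonneg (*-nonneg (×#-nonneg n) (proj₂ (proj₂ (scale j)) A (A-large j) (row j))))

      weights-sum : sum (λ i → κ * w (enumerate n i)) ≈ 1#
      weights-sum = begin
        sum (λ i → κ * w (enumerate n i))     ≈⟨ sum-cong-≋ {n !} (λ i → *-identityʳ (κ * w (enumerate n i))) ⟨
        -- The total weight is the weighted coordinate sum for f = 1, evaluated at an arbitrary
        -- position.
        ∑w (λ _ → 1#)                          ≈⟨ ∑w-entry (λ _ → 1#) zero ⟩
        κ * (N * sum (λ v → D zero v * 1#)) ≈⟨ *-congˡ (*-congˡ (trans (sum-cong-≋ {n} λ v → *-identityʳ (D zero v)) (D-rows A zero))) ⟩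
        κ * (N * ρ)                          ≈⟨ solve 3 (λ κ N ρ → κ :* (N :* ρ) := (ρ :* N) :* κ) refl κ N ρ ⟩
        (ρ * N) * κ                          ≈⟨ proj₂ normaliser ⟩
        1#                                     ∎

      y∈Q : Q y
      y∈Q = Equivalence.from (Q-intersection y)
        ( affineCombination isAffineSubspace (h-L Perm.id) (λ i → κ * w (enumerate n i)) (λ i j → h j (enumerate n i))
            (λ i → h-L (enumerate n i)) weights-sum
        , y-nonneg)

      py : ∀ b → p y b ≈ κ * (N * sum (λ v → D b v * value v))
      py b = begin
        p y b
          ≈⟨ linear-sum linear (λ i → κ * w (enumerate n i)) (λ i j → h j (enumerate n i)) b ⟩
        sum (λ i → (κ * w (enumerate n i)) * p (to (point (enumerate n i))) b)
          ≈⟨ sum-cong-≋ {n !} (λ i → *-congˡ {κ * w (enumerate n i)} (p-right (point (enumerate n i)) b)) ⟩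
        ∑w (entry value b)
          ≈⟨ ∑w-entry value b ⟩
        κ * (N * sum (λ v → D b v * value v))
          ∎

      overshoot : Carrier
      overshoot = κ * N * P * R

      A*overshoot≈1 : A * overshoot ≈ 1#
      A*overshoot≈1 = trans
        (solve 5 (λ A κ N P R → A :* (κ :* N :* P :* R) := (A :* P :* R :* N) :* κ) refl A κ N P R) (proj₂ normaliser)

      -- `value last` and `value first` differ by 1, so the perturbation in `D` lowers each
      -- coordinate below the cut by κ N R. Over `P` positions this is `overshoot`, while the
      -- unperturbed part sums to `M`.
      slack-py : slack (p y) ≈ - overshoot
      slack-py = begin
        sum (λ b → lo b * p y b) - M
          ≈⟨ +-congʳ (sum-cong-≋ {n} summand) ⟩
        sum (λ b → (κ * N * (R * (A * M - 1#))) * lo b) - M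
          ≈⟨ +-congʳ (*-distribˡ-sum (κ * N * (R * (A * M - 1#))) lo) ⟨
        (κ * N * (R * (A * M - 1#))) * P - M
          ≈⟨ solve 6 (λ κ N R A M P → (κ :* N :* (R :* (A :* M :- con (1 , 0)))) :* P :- M :=
               (A :* (κ :* N :* P :* R)) :* M :- M :- κ :* N :* P :* R) refl κ N R A M P ⟩
        (A * overshoot) * M - M - overshoot
          ≈⟨ +-congʳ (+-congʳ (*-congʳ A*overshoot≈1)) ⟩
        1# * M - M - overshoot
          ≈⟨ solve 2 (λ M o → con (1 , 0) :* M :- M :- o := :- o) refl M overshoot ⟩
        - overshoot
          ∎
        where
        M : Carrier
        M = sum λ v → lo v * value v

        H : Carrier
        H = sum λ v → hi v * value v

        last-first : value last - value first ≈ - 1#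
        last-first = trans (+-congʳ (reflexive (cong (λ i → suc i ×# 1#) (toℕ-inject₁ m))))
          (solve 1 (λ c → c :- (con (1 , 0) :+ c) := :- con (1 , 0)) refl (suc (toℕ m) ×# 1#))

        summand : ∀ b → lo b * p y b ≈ (κ * N * (R * (A * M - 1#))) * lo b
        summand b = begin
          lo b * p y b
            ≈⟨ *-congˡ {lo b} (trans (py b) (*-congˡ (*-congˡ (trans (D-sum A b value)
                 (+-cong (*-congˡ {lo b} (*-congˡ {R} (+-congˡ last-first))) (*-congˡ {hi b} (*-congˡ {P} (+-congˡ (-‿cong last-first))))))))) ⟩
          lo b * (κ * (N * (lo b * (R * (A * M - 1#)) + hi b * (P * (A * H - - 1#)))))
            ≈⟨ indicator-select (below b) κ N (R * (A * M - 1#)) (P * (A * H - - 1#)) ⟩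
          (κ * N * (R * (A * M - 1#))) * lo b
            ∎

      impossible : ⊥
      impossible = 1≉0 (begin
        1#                ≈⟨ A*overshoot≈1 ⟨
        A * overshoot    ≈⟨ *-congˡ overshoot≈0 ⟩
        A * 0#           ≈⟨ zeroʳ A ⟩
        0#                ∎)
        where
        overshoot≈0 : overshoot ≈ 0#
        overshoot≈0 = nonneg-antisym
          (*-nonneg (*-nonneg (*-nonneg κ-nonneg (order-nonneg n)) P-nonneg) R-nonneg)
          -- As `y` lies in `Q`, its image satisfies the facet inequality, so the negative of
          -- `overshoot` is nonnegative.
          (≤-respʳ-≈ slack-py (slack-permutahedron (Equivalence.from (p-image (p y)) (y , y∈Q , λ _ → refl))))

  noSmallExtension : ∀ {k d} {Q : Pred (Vector Carrier d) 0ℓ} {p : Vector Carrier d → Vector Carrier (4 ℕ.+ k)} →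
    IsSubspaceExtension Q p → (s : MapFromX (4 ℕ.+ k) d) → IsWeaklySymmetricSection Q p s →
    ¬ (d ℕ.* 2 ℕ.< (4 ℕ.+ k) ℕ.* (3 ℕ.+ k))
  noSmallExtension extension s weaklySymmetric d-small = impossible (proj₁ good) (proj₂ good)
    where
    open Section extension s weaklySymmetric

    good = goodThreshold (λ j → T (h j)) (λ j → T-nonneg (h-nonneg j))
      (λ j → ∑ₚ (h j) , T-columns (h j)) T-symmetric d-small

open import Data.Nat.Base using (_≤_; _<_; _*_; _∸_; _/_)

theorem6 : (ℝ : Reals) →
    let open Reals ℝ using (Carrier)
        open Reals ℝ using (_≈_)
        open Extensions ℝ in
    (n d : ℕ) → 6 ≤ n → d < n * (n ∸ 1) / 2 →
    (Q : Pred (Vector Carrier d) 0ℓ) (p : Vector Carrier d → Vector Carrier n) →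
    IsSubspaceExtension Q p →
    (s : MapFromX n d) → IsWeaklySymmetricSection Q p s →
    let open Func s using (to) in
    ∃[ k ] ∃[ m ] Σ (LabelledPartition d n k m) λ P →
      let open LabelledPartition P in
      (∀ π → Alternating n π → ∀ x i t →
        to (π ∙ˣ x) (a i t) ≈ to x (a i (π ⟨$⟩ˡ t))) ×
      (∀ π → Alternating n π → ∀ x j →
        to (π ∙ˣ x) (b j) ≈ to x (b j))
theorem6 ℝ _ d (ℕ.s≤s (ℕ.s≤s (ℕ.s≤s (ℕ.s≤s _)))) d<n[n-1]/2 Q p extension s weaklySymmetric =
  ⊥-elim (Nonexistence.noSmallExtension ℝ extension s weaklySymmetric (<half⇒*2< d<n[n-1]/2))
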